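{- Let $r\ge 1$ and let $\Gamma \cong (\mathbb{Z}/2^r\mathbb{Z},\langle\cdot,\cdot\rangle)$ be a cyclic $2$-group with non-exceptional pairing $\langle\cdot,\cdot\rangle$. Then there exists a graph $G$ such that $\Gamma \cong \mathrm{Jac}(G)$ as groups with pairing.
   Context: A group with pairing is a finite abelian group $\Gamma$ together with a symmetric, bilinear, non-degenerate pairing $\langle\cdot,\cdot\rangle : \Gamma\times\Gamma \to \mathbb{Q}/\mathbb{Z}$; an isomorphism of groups with pairing is a group isomorphism preserving the pairings. The non-exceptional pairings on $\mathbb{Z}/2^r\mathbb{Z}$ are, up to isomorphism, the following: $\langle x,y\rangle = \frac{xy}{2^r}$ (for $r\ge1$), $\langle x,y\rangle=\frac{ -xy}{2^r}$ (for $r\ge 2$), $\langle x,y\rangle=\frac{5xy}{2^r}$ (for $r\ge3$), and $\langle x,y\rangle=\frac{ -5xy}{2^r}$ (for $r\ge 3$). A graph is a finite connected graph, possibly with multiple edges, but without loops. A divisor on $G$ is a formal integral combination $D=\sum_{v\in V(G)} D(v)v$, of degree $\sum_v D(v)$. For $f: V(G)\to\mathbb{Z}$ put $\mathrm{ord}_v(f)=\sum_{e=vw}(f(v)-f(w))$, the sum being over edges $e$ containing $v$ (counted with multiplicity), and $\mathrm{div}(f)=\sum_v \mathrm{ord}_v(f)v$. Divisors of the form $\mathrm{div}(f)$ are principal. The Jacobian $\mathrm{Jac}(G)$ is the (finite) group of degree-zero divisors modulo principal divisors. It carries the monodromy pairing: for degree-zero divisors $D_1,D_2$, choose an integer $m\geq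 1$ and $f: V(G)\to\mathbb{Z}$ with $\mathrm{div}(f)=mD_1$, and set $\langle D_1,D_2\rangle=\frac1m\sum_{v\in V(G)} D_2(v)f(v) \in \mathbb{Q}/\mathbb{Z}$. As a group with pairing, $\mathrm{Jac}(G)$ is always equipped with this pairing. -}

module Defs where

open import Algebra.Bundles using (AbelianGroup)
open import Algebra.Morphism.Structures using (module GroupMorphisms)
import Algebra.Properties.AbelianGroup as AbelianGroupProperties
import Algebra.Properties.Semiring.Sum as Sum
open import Data.Fin.Base
  using (Fin; zero; suc; toℕ; fromℕ<; finToFun; funToFin; punchIn)
import Data.Fin.Properties as Fin
open import Data.Integer.Base
  using (ℤ; +_; -[1+_]; 0ℤ; 1ℤ; -_; _+_; _-_; _*_; _≤_; ∣_∣)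
import Data.Integer.DivMod as ℤ
open import Data.Integer.Divisibility.Signed
  using (_∣_; divides; _∣?_; ∣⇒∣ᵤ; ∣ᵤ⇒∣; ∣m∣n⇒∣m+n; ∣m⇒∣-m)
import Data.Integer.Properties as ℤ
open import Data.Integer.Tactic.RingSolver using (solve-∀)
open import Data.List.Base using (List; _∷_; lookup; tabulate; deduplicate; length)
import Data.List.Relation.Unary.All as All
open import Data.List.Membership.Propositional.Properties using (∈-lookup)
import Data.List.Relation.Unary.AllPairs as AllPairs
open import Data.List.Relation.Unary.Any using (Any; index)
open import Data.List.Relation.Unary.Any.Properties using (lookup-index; tabulate⁺)
open import Data.List.Relation.Unary.Enumerates.Setoid.Properties
  using (deduplicate⁺)
open import Data.List.Relation.Unary.Unique.DecSetoid.Properties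
  using (deduplicate-!)
open import Data.List.Relation.Unary.Unique.Setoid using (Unique)
import Data.Nat.Base as ℕ
open import Data.Nat.Base using (ℕ; zero; suc; NonZero; _^_)
import Data.Nat.Coprimality as ℕ
import Data.Nat.Divisibility as ℕ
open import Data.Nat.Primality using (prime⇒irreducible; prime[2])
import Data.Nat.Properties as ℕ
open import Data.Product.Base using (∃; _×_; _,_; proj₁; proj₂)
open import Data.Rational.Unnormalised.Base as ℚᵘ using (ℚᵘ; _/_; _≃_; *≡*; 0ℚᵘ)
import Data.Rational.Unnormalised.Properties as ℚᵘ
open import Data.Sum.Base using (inj₁; inj₂)
open import Data.Vec.Functional using (insertAt)
open import Data.Vec.Functional.Properties using (insertAt-lookup; insertAt-punchIn)
open import Function.Bundles using (Inverse)
open import Level using (Level; _⊔_; 0ℓ)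
open import Relation.Binary.Bundles using (Setoid; DecSetoid)
open import Relation.Binary.Construct.Closure.ReflexiveTransitive using (Star; ε; _◅_)
open import Relation.Binary.PropositionalEquality
  using (_≡_; _≢_; refl; sym; trans; cong; cong₂; subst; module ≡-Reasoning)
import Relation.Binary.PropositionalEquality as ≡
import Relation.Binary.Reasoning.Setoid as SetoidReasoning
open import Relation.Nullary
  using (Dec; yes; no; ¬_; ¬?; contradiction; decidable-stable; map′)
open import Relation.Nullary.Decidable using (False; toWitnessFalse)

open Sum ℤ.+-*-semiring using (sum; sum-syntax; ∑-comm; ∑-distrib-+; sum-cong-≗;
  *-distribˡ-sum; sum-remove; sum-replicate-zero)

private
  variable
    a b c ℓ ℓ₁ ℓ₂ ℓ₃ : Level

record Subgroup (A : AbelianGroup c ℓ) ℓ₃ : Set (c ⊔ ℓ ⊔ Level.suc ℓ₃) where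
  open AbelianGroup A renaming (ε to 0#)
  field
    Member    : Carrier → Set ℓ₃
    resp      : ∀ {x y} → x ≈ y → Member x → Member y
    0#-member : Member 0#
    ∙-closed  : ∀ {x y} → Member x → Member y → Member (x ∙ y)
    ⁻¹-closed : ∀ {x} → Member x → Member (x ⁻¹)

module _ (A : AbelianGroup c ℓ) (N : Subgroup A ℓ₃) where
  open AbelianGroup A renaming (ε to 0#; _-_ to _//_; refl to ≈-refl; sym to ≈-sym; trans to ≈-trans)
  open AbelianGroupProperties A using (⁻¹-anti-homo‿-; ⁻¹-∙-comm)
  open Subgroup N
  open SetoidReasoning (AbelianGroup.setoid A)

  private
    _∼_ : Carrier → Carrier → Set _
    x ∼ y = Member (x // y)

    ≈⇒∼ : ∀ {x y} → x ≈ y → x ∼ y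
    ≈⇒∼ {x} {y} x≈y = resp (≈-sym (≈-trans (∙-congʳ x≈y) (inverseʳ y))) 0#-member

    ∼-trans : ∀ {x y z} → x ∼ y → y ∼ z → x ∼ z
    ∼-trans {x} {y} {z} x∼y y∼z = resp (begin
      (x // y) ∙ (y // z)      ≈⟨ assoc x (y ⁻¹) (y // z) ⟩
      x ∙ (y ⁻¹ ∙ (y // z))   ≈⟨ ∙-congˡ (assoc (y ⁻¹) y (z ⁻¹)) ⟨
      x ∙ (y ⁻¹ ∙ y ∙ z ⁻¹)  ≈⟨ ∙-congˡ (∙-congʳ (inverseˡ y)) ⟩
      x ∙ (0# ∙ z ⁻¹)        ≈⟨ ∙-congˡ (identityˡ (z ⁻¹)) ⟩
      x // z                  ∎) (∙-closed x∼y y∼z)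

    ∼-∙-cong : ∀ {x y u v} → x ∼ y → u ∼ v → (x ∙ u) ∼ (y ∙ v)
    ∼-∙-cong {x} {y} {u} {v} x∼y u∼v = resp (begin
      (x ∙ y ⁻¹) ∙ (u ∙ v ⁻¹)  ≈⟨ assoc x (y ⁻¹) (u ∙ v ⁻¹) ⟩
      x ∙ (y ⁻¹ ∙ (u ∙ v ⁻¹))  ≈⟨ ∙-congˡ (assoc (y ⁻¹) u (v ⁻¹)) ⟨
      x ∙ (y ⁻¹ ∙ u ∙ v ⁻¹)    ≈⟨ ∙-congˡ (∙-congʳ (comm (y ⁻¹) u)) ⟩
      x ∙ (u ∙ y ⁻¹ ∙ v ⁻¹)    ≈⟨ ∙-congˡ (assoc u (y ⁻¹) (v ⁻¹)) ⟩
      x ∙ (u ∙ (y ⁻¹ ∙ v ⁻¹))  ≈⟨ assoc x u (y ⁻¹ ∙ v ⁻¹) ⟨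
      (x ∙ u) ∙ (y ⁻¹ ∙ v ⁻¹)  ≈⟨ ∙-congˡ (⁻¹-∙-comm y v) ⟩
      (x ∙ u) ∙ (y ∙ v) ⁻¹     ∎) (∙-closed x∼y u∼v)

  -- The carrier is that of A; the equality is x - y ∈ N.
  Quotient : AbelianGroup c ℓ₃
  Quotient = record
    { Carrier = Carrier ; _≈_ = _∼_ ; _∙_ = _∙_ ; ε = 0# ; _⁻¹ = _⁻¹
    ; isAbelianGroup = record
      { isGroup = record
        { isMonoid = record
          { isSemigroup = record
            { isMagma = record
              { isEquivalence = record
                { refl  = ≈⇒∼ ≈-refl
                ; sym   = λ {x} {y} x∼y → resp (⁻¹-anti-homo‿- x y) (⁻¹-closed x∼y)
                ; trans = ∼-trans
                }
              ; ∙-cong = ∼-∙-cong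
              }
            ; assoc = λ x y z → ≈⇒∼ (assoc x y z)
            }
          ; identity = (λ x → ≈⇒∼ (identityˡ x)) , (λ x → ≈⇒∼ (identityʳ x))
          }
        ; inverse = (λ x → ≈⇒∼ (inverseˡ x)) , (λ x → ≈⇒∼ (inverseʳ x))
        ; ⁻¹-cong = λ {x} {y} x∼y →
            resp (≈-sym (⁻¹-∙-comm x (y ⁻¹))) (⁻¹-closed x∼y)
        }
      ; comm = λ x y → ≈⇒∼ (comm x y)
      }
    }

  quotient-reflexive : ∀ {x y} → x ≈ y → AbelianGroup._≈_ Quotient x y
  quotient-reflexive = ≈⇒∼

integers : Subgroup ℚᵘ.+-0-abelianGroup 0ℓ
integers = record
  { Member    = λ q → ∃ λ (k : ℤ) → q ≃ k / 1
  ; resp      = λ p≃q (k , p≃k) → k , ℚᵘ.≃-trans (ℚᵘ.≃-sym p≃q) p≃k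
  ; 0#-member = 0ℤ , ℚᵘ.≃-refl
  ; ∙-closed  = λ (j , p≃j) (k , q≃k) → j + k ,
      ℚᵘ.≃-trans (ℚᵘ.+-cong p≃j q≃k) (*≡* (+-/1 j k))
  ; ⁻¹-closed = λ (k , q≃k) → - k , ℚᵘ.-‿cong q≃k
  }
  where
  +-/1 : ∀ j k → (j * 1ℤ + k * 1ℤ) * 1ℤ ≡ (j + k) * 1ℤ
  +-/1 = solve-∀

ℚ/ℤ : AbelianGroup 0ℓ 0ℓ
ℚ/ℤ = Quotient ℚᵘ.+-0-abelianGroup integers

module ℚ/ℤ = AbelianGroup ℚ/ℤ

≃⇒≈ : ∀ {p q} → p ≃ q → p ℚ/ℤ.≈ q
≃⇒≈ = quotient-reflexive ℚᵘ.+-0-abelianGroup integers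

/-≃ : ∀ a b m n .{{_ : NonZero m}} .{{_ : NonZero n}} →
      a * + n ≡ b * + m → a / m ≃ b / n
/-≃ a b (suc m) (suc n) eq = *≡* eq

/-‿- : ∀ a b m n → (a / suc m) ℚᵘ.- (b / suc n) ≃
       (a * + suc n - b * + suc m) / (suc m ℕ.* suc n)
/-‿- a b m n = *≡* (cong (λ x → (a * + suc n + x) * + (suc m ℕ.* suc n))
  (sym (ℤ.neg-distribˡ-* b (+ suc m))))

/-≈-intro : ∀ a b m n .{{_ : NonZero m}} .{{_ : NonZero n}} k →
            a * + n - b * + m ≡ k * (+ m * + n) → a / m ℚ/ℤ.≈ b / n
/-≈-intro a b (suc m) (suc n) k eq = k , ℚᵘ.≃-trans (/-‿- a b m n) (*≡*
  (trans (ℤ.*-identityʳ _) (trans eq (cong (k *_) (sym (ℤ.pos-* (suc m) (suc n)))))))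

/-≈-elim : ∀ a b m n .{{_ : NonZero m}} .{{_ : NonZero n}} →
           a / m ℚ/ℤ.≈ b / n → ∃ λ k → a * + n - b * + m ≡ k * (+ m * + n)
/-≈-elim a b (suc m) (suc n) (k , eq)
  with *≡* eq′ ← ℚᵘ.≃-trans (ℚᵘ.≃-sym (/-‿- a b m n)) eq
  = k , trans (sym (ℤ.*-identityʳ _)) (trans eq′ (cong (k *_) (ℤ.pos-* (suc m) (suc n))))

/-≈0-elim : ∀ a m .{{_ : NonZero m}} → a / m ℚ/ℤ.≈ 0ℚᵘ → + m ∣ a
/-≈0-elim a m a/m≈0 with k , eq ← /-≈-elim a 0ℤ m 1 a/m≈0 =
  divides k (trans (lemma₁ a (+ m)) (trans eq (lemma₂ k (+ m))))
  where
  lemma₁ : ∀ a m → a ≡ a * 1ℤ - 0ℤ * m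
  lemma₁ = solve-∀
  lemma₂ : ∀ k m → k * (m * 1ℤ) ≡ k * m
  lemma₂ = solve-∀

/-+ : ∀ a b m .{{_ : NonZero m}} → (a + b) / m ≃ (a / m) ℚᵘ.+ (b / m)
/-+ a b (suc m) = *≡* (trans
  (cong ((a + b) *_) (ℤ.pos-* (suc m) (suc m))) (lemma a b (+ suc m)))
  where
  lemma : ∀ a b m → (a + b) * (m * m) ≡ (a * m + b * m) * m
  lemma = solve-∀

Finite : Setoid c ℓ → Set (c ⊔ ℓ)
Finite S = ∃ λ n → Inverse S (≡.setoid (Fin n))

record Pairing (A : AbelianGroup c ℓ) : Set (c ⊔ ℓ) where
  open AbelianGroup A renaming (ε to 0#)
  field
    ⟨_,_⟩         : Carrier → Carrier → ℚ/ℤ.Carrier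
    ⟨⟩-cong       : ∀ {x x′ y y′} → x ≈ x′ → y ≈ y′ → ⟨ x , y ⟩ ℚ/ℤ.≈ ⟨ x′ , y′ ⟩
    symmetric     : ∀ x y → ⟨ x , y ⟩ ℚ/ℤ.≈ ⟨ y , x ⟩
    additiveˡ     : ∀ x x′ y → ⟨ x ∙ x′ , y ⟩ ℚ/ℤ.≈ ⟨ x , y ⟩ ℚ/ℤ.∙ ⟨ x′ , y ⟩
    additiveʳ     : ∀ x y y′ → ⟨ x , y ∙ y′ ⟩ ℚ/ℤ.≈ ⟨ x , y ⟩ ℚ/ℤ.∙ ⟨ x , y′ ⟩
    -- Injectivity of A → Hom(A, ℚ/ℤ), hence bijectivity when A is finite.
    nondegenerate : ∀ x → (∀ y → ⟨ x , y ⟩ ℚ/ℤ.≈ ℚ/ℤ.ε) → x ≈ 0#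

record GroupWithPairing c ℓ : Set (Level.suc (c ⊔ ℓ)) where
  field
    abelianGroup : AbelianGroup c ℓ
  open AbelianGroup abelianGroup public
  field
    finite  : Finite setoid
    pairing : Pairing abelianGroup
  open Pairing pairing public

infix 4 _≅_

record _≅_ (Γ : GroupWithPairing a ℓ₁) (Δ : GroupWithPairing b ℓ₂)
           : Set (a ⊔ b ⊔ ℓ₁ ⊔ ℓ₂) where
  private
    module Γ = GroupWithPairing Γ
    module Δ = GroupWithPairing Δ
  open GroupMorphisms Γ.rawGroup Δ.rawGroup using (IsGroupIsomorphism)
  field
    to                 : Γ.Carrier → Δ.Carrier
    isGroupIsomorphism : IsGroupIsomorphism to
    preserves-⟨⟩       : ∀ x y → Δ.⟨ to x , to y ⟩ ℚ/ℤ.≈ Γ.⟨ x , y ⟩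

module _ (S : Setoid c ℓ) where
  open Setoid S using (_≈_) renaming (sym to ≈-sym)

  lookup-injective : ∀ {xs} → Unique S xs →
                     ∀ i j → lookup xs i ≈ lookup xs j → i ≡ j
  lookup-injective (_ AllPairs.∷ _)     zero    zero    _  = refl
  lookup-injective (x≉xs AllPairs.∷ _)  zero    (suc j) eq =
    contradiction eq (All.lookup x≉xs (∈-lookup j))
  lookup-injective (x≉xs AllPairs.∷ _)  (suc i) zero    eq =
    contradiction (≈-sym eq) (All.lookup x≉xs (∈-lookup i))
  lookup-injective (_ AllPairs.∷ xs!)   (suc i) (suc j) eq =
    cong suc (lookup-injective xs! i j eq)

module _ (S? : DecSetoid c ℓ) where
  open DecSetoid S? using (Carrier; _≈_; _≟_; setoid)
    renaming (refl to ≈-refl; sym to ≈-sym; trans to ≈-trans)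

  enumerated⇒finite : ∀ {k} (g : Fin k → Carrier) →
                      (∀ x → ∃ λ i → x ≈ g i) → Finite setoid
  enumerated⇒finite g g-surjective = length xs , record
    { to        = to
    ; from      = lookup xs
    ; to-cong   = λ {x} {y} x≈y → lookup-injective setoid xs! (to x) (to y)
        (≈-trans (≈-sym (x≈xs[to-x] x)) (≈-trans x≈y (x≈xs[to-x] y)))
    ; from-cong = λ { refl → ≈-refl }
    ; inverse   =
        (λ {i} {x} x≈xs[i] → lookup-injective setoid xs! (to x) i
          (≈-trans (≈-sym (x≈xs[to-x] x)) x≈xs[i])) ,
        (λ { {x} refl → ≈-sym (x≈xs[to-x] x) })
    }
    where
    xs : List Carrier
    xs = deduplicate _≟_ (tabulate g)

    xs! : Unique setoid xs
    xs! = deduplicate-! S? (tabulate g)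

    x∈xs : ∀ x → Any (x ≈_) xs
    x∈xs = deduplicate⁺ S? (λ x → tabulate⁺ (proj₁ (g-surjective x)) (proj₂ (g-surjective x)))

    to : Carrier → Fin (length xs)
    to x = index (x∈xs x)

    x≈xs[to-x] : ∀ x → x ≈ lookup xs (to x)
    x≈xs[to-x] x = lookup-index (x∈xs x)

infix 8 ℤ/_

multiplesOf : ℕ → Subgroup ℤ.+-0-abelianGroup 0ℓ
multiplesOf n = record
  { Member    = + n ∣_
  ; resp      = subst (+ n ∣_)
  ; 0#-member = divides 0ℤ refl
  ; ∙-closed  = ∣m∣n⇒∣m+n
  ; ⁻¹-closed = ∣m⇒∣-m
  }

ℤ/_ : ℕ → AbelianGroup 0ℓ 0ℓ
ℤ/ n = Quotient ℤ.+-0-abelianGroup (multiplesOf n)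

ℤ/n-finite : ∀ n .{{_ : NonZero n}} → Finite (AbelianGroup.setoid (ℤ/ n))
ℤ/n-finite n = enumerated⇒finite
  (record { isDecEquivalence = record
    { isEquivalence = AbelianGroup.isEquivalence (ℤ/ n)
    ; _≟_           = λ x y → + n ∣? (x - y) } })
  (λ i → + toℕ i)
  (λ x → fromℕ< (ℤ.n%ℕd<d x n) , divides (x ℤ./ℕ n) (begin
    x - + toℕ (fromℕ< (ℤ.n%ℕd<d x n))          ≡⟨ cong (λ i → x - + i) (Fin.toℕ-fromℕ< (ℤ.n%ℕd<d x n)) ⟩
    x - + (x ℤ.%ℕ n)                           ≡⟨ cong (_- + (x ℤ.%ℕ n)) (ℤ.a≡a%ℕn+[a/ℕn]*n x n) ⟩
    + (x ℤ.%ℕ n) + x ℤ./ℕ n * + n - + (x ℤ.%ℕ n) ≡⟨ lemma (+ (x ℤ.%ℕ n)) (x ℤ./ℕ n * + n) ⟩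
    x ℤ./ℕ n * + n                             ∎))
  where
  open ≡-Reasoning
  lemma : ∀ r s → r + s - r ≡ s
  lemma = solve-∀

module _ (n : ℕ) .{{_ : NonZero n}} (u : ℤ) (n⊥u : ℕ.Coprime n ∣ u ∣) where

  /n-cong : ∀ a b → + n ∣ a - b → a / n ℚ/ℤ.≈ b / n
  /n-cong a b (divides k eq) = /-≈-intro a b n n k (begin
    a * + n - b * + n    ≡⟨ factor a b (+ n) ⟩
    (a - b) * + n        ≡⟨ cong (_* + n) eq ⟩
    k * + n * + n        ≡⟨ ℤ.*-assoc k (+ n) (+ n) ⟩
    k * (+ n * + n)      ∎)
    where
    open ≡-Reasoning
    factor : ∀ a b n → a * n - b * n ≡ (a - b) * n
    factor = solve-∀

  /n-cong-≡ : ∀ {a b} → a ≡ b → a / n ℚ/ℤ.≈ b / n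
  /n-cong-≡ {a} refl = ℚ/ℤ.refl {a / n}

  unitPairing : Pairing (ℤ/ n)
  unitPairing = record
    { ⟨_,_⟩     = λ x y → (u * x * y) / n
    ; ⟨⟩-cong   = λ {x} {x′} {y} {y′} (divides j x≈x′) (divides k y≈y′) →
        /n-cong (u * x * y) (u * x′ * y′) (divides (j * (u * y) + k * (u * x′)) (begin
          u * x * y - u * x′ * y′                      ≡⟨ split u x x′ y y′ ⟩
          (x - x′) * (u * y) + (y - y′) * (u * x′)     ≡⟨ cong₂ (λ s t → s * (u * y) + t * (u * x′)) x≈x′ y≈y′ ⟩
          j * + n * (u * y) + k * + n * (u * x′)       ≡⟨ collect j k (+ n) (u * y) (u * x′) ⟩
          (j * (u * y) + k * (u * x′)) * + n           ∎))
    ; symmetric = λ x y → /n-cong-≡ (swap u x y)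
    ; additiveˡ = λ x x′ y → ℚ/ℤ.trans {(u * (x + x′) * y) / n}
        (/n-cong-≡ (distribˡ u x x′ y)) (≃⇒≈ (/-+ (u * x * y) (u * x′ * y) n))
    ; additiveʳ = λ x y y′ → ℚ/ℤ.trans {(u * x * (y + y′)) / n}
        (/n-cong-≡ (ℤ.*-distribˡ-+ (u * x) y y′)) (≃⇒≈ (/-+ (u * x * y) (u * x * y′) n))
    ; nondegenerate = λ x x⊥ → subst (+ n ∣_) (sym (ℤ.+-identityʳ x))
        (∣ᵤ⇒∣ (ℕ.coprime-divisor n⊥u (subst (n ℕ.∣_) (ℤ.abs-* u x)
          (∣⇒∣ᵤ (subst (+ n ∣_) (ℤ.*-identityʳ (u * x)) (/-≈0-elim (u * x * 1ℤ) n (x⊥ 1ℤ)))))))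
    }
    where
    open ≡-Reasoning
    split : ∀ u x x′ y y′ → u * x * y - u * x′ * y′ ≡ (x - x′) * (u * y) + (y - y′) * (u * x′)
    split = solve-∀
    collect : ∀ j k n s t → j * n * s + k * n * t ≡ (j * s + k * t) * n
    collect = solve-∀
    swap : ∀ u x y → u * x * y ≡ u * y * x
    swap = solve-∀
    distribˡ : ∀ u x x′ y → u * (x + x′) * y ≡ u * x * y + u * x′ * y
    distribˡ = solve-∀

2^r⊥odd : ∀ r {m} → ¬ 2 ℕ.∣ m → ℕ.Coprime (2 ^ r) m
2^r⊥odd zero    2∤m (d∣1 , _)         = ℕ.∣1⇒≡1 d∣1
2^r⊥odd (suc r) 2∤m {d} (d∣2^r , d∣m) = 2^r⊥odd r 2∤m (ℕ.coprime-divisor d⊥2 d∣2^r , d∣m)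
  where
  d⊥2 : ℕ.Coprime d 2
  d⊥2 (e∣d , e∣2) with prime⇒irreducible prime[2] e∣2
  ... | inj₁ e≡1  = e≡1
  ... | inj₂ refl = contradiction (ℕ.∣-trans e∣d d∣m) 2∤m

2^_-nonZero : ∀ r → NonZero (2 ^ r)
2^ r -nonZero = ℕ.m^n≢0 2 r

-- The pairing ⟨ x , y ⟩ = u x y / 2 ^ r on ℤ/2ʳ, for odd u.
oddPairing : ∀ r (u : ℤ) {u-odd : False (2 ℕ.∣? ∣ u ∣)} → Pairing (ℤ/ (2 ^ r))
oddPairing r u {u-odd} =
  unitPairing (2 ^ r) {{2^ r -nonZero}} u (2^r⊥odd r (toWitnessFalse u-odd))

cyclic : ∀ r → Pairing (ℤ/ (2 ^ r)) → GroupWithPairing 0ℓ 0ℓ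
cyclic r P = record
  { abelianGroup = ℤ/ (2 ^ r)
  ; finite       = ℤ/n-finite (2 ^ r) {{2^ r -nonZero}}
  ; pairing      = P
  }

-- The classification, up to isomorphism, of the non-exceptional pairings on
-- ℤ/2ʳ; the bounds on r make the list irredundant.
data NonExceptional (r : ℕ) (P : Pairing (ℤ/ (2 ^ r))) : Set where
  +1-type : r ℕ.≥ 1 → cyclic r P ≅ cyclic r (oddPairing r (+ 1))   → NonExceptional r P
  -1-type : r ℕ.≥ 2 → cyclic r P ≅ cyclic r (oddPairing r (- + 1)) → NonExceptional r P
  +5-type : r ℕ.≥ 3 → cyclic r P ≅ cyclic r (oddPairing r (+ 5))   → NonExceptional r P
  -5-type : r ℕ.≥ 3 → cyclic r P ≅ cyclic r (oddPairing r (- + 5)) → NonExceptional r P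

record Graph : Set where
  field
    order : ℕ

  Vertex : Set
  Vertex = Fin order

  field
    edges     : Vertex → Vertex → ℕ -- the number of edges joining two vertices
    edges-sym : ∀ v w → edges v w ≡ edges w v
    loopless  : ∀ v → edges v v ≡ 0
    nonempty  : 0 ℕ.< order
    connected : ∀ v w → Star (λ x y → 0 ℕ.< edges x y) v w

  Divisor : Set
  Divisor = Vertex → ℤ

  degree : Divisor → ℤ
  degree D = ∑[ v < order ] D v

  -- The coefficient of div f at v is the order ord_v(f).
  div : (Vertex → ℤ) → Divisor
  div f v = ∑[ w < order ] (+ edges v w * (f v - f w))

∑-minus : ∀ {n} (s t : Fin n → ℤ) → ∑[ i < n ] (s i - t i) ≡ sum s - sum t
∑-minus {zero}  s t = refl
∑-minus {suc n} s t = trans (cong (λ x → s zero - t zero + x) (∑-minus (λ i → s (suc i)) (λ i → t (suc i)))) (lemma (s zero) (t zero) _ _)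
  where
  lemma : ∀ s t ss ts → s - t + (ss - ts) ≡ s + ss - (t + ts)
  lemma = solve-∀

∑-neg : ∀ {n} (t : Fin n → ℤ) → ∑[ i < n ] (- t i) ≡ - sum t
∑-neg {zero}  t = refl
∑-neg {suc n} t = trans (cong (λ x → - t zero + x) (∑-neg (λ i → t (suc i))))
  (sym (ℤ.neg-distrib-+ (t zero) (∑[ i < n ] t (suc i))))

∑-*ˡ : ∀ {n} k (t : Fin n → ℤ) → ∑[ i < n ] (k * t i) ≡ k * sum t
∑-*ˡ k t = sym (*-distribˡ-sum k t)

∑-0 : ∀ {n} {t : Fin n → ℤ} → (∀ i → t i ≡ 0ℤ) → sum t ≡ 0ℤ
∑-0 {n} t≗0 = trans (sum-cong-≗ t≗0) (sum-replicate-zero n)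

∑-nonneg : ∀ {n} {t : Fin n → ℤ} → (∀ i → 0ℤ ≤ t i) → 0ℤ ≤ sum t
∑-nonneg {zero}  _   = ℤ.≤-refl
∑-nonneg {suc n} 0≤t = ℤ.+-mono-≤ (0≤t zero) (∑-nonneg (λ i → 0≤t (suc i)))

∑-nonneg-0 : ∀ {n} (t : Fin n → ℤ) → (∀ i → 0ℤ ≤ t i) → sum t ≡ 0ℤ → ∀ i → t i ≡ 0ℤ
∑-nonneg-0 {suc n} t 0≤t ∑t≡0 = λ where
    zero    → t₀≡0
    (suc i) → ∑-nonneg-0 (λ i → t (suc i)) (λ i → 0≤t (suc i)) ∑t′≡0 i
  where
  ∑t′ : ℤ
  ∑t′ = ∑[ i < n ] t (suc i)
  t₀≡0 : t zero ≡ 0ℤ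
  t₀≡0 = ℤ.≤-antisym (subst (λ x → t zero ≤ x) ∑t≡0 (subst (λ x → x ≤ t zero + ∑t′) (ℤ.+-identityʳ (t zero))
    (ℤ.+-monoʳ-≤ (t zero) (∑-nonneg (λ i → 0≤t (suc i)))))) (0≤t zero)
  ∑t′≡0 : ∑t′ ≡ 0ℤ
  ∑t′≡0 = trans (sym (ℤ.+-identityˡ ∑t′)) (trans (cong (_+ ∑t′) (sym t₀≡0)) ∑t≡0)

maximum : ∀ {n} (f : Fin n → ℤ) → Fin n → ∃ λ i → ∀ j → f j ≤ f i
maximum {suc zero}    f _ = zero , λ { zero → ℤ.≤-refl }
maximum {suc (suc n)} f _ with i , f≤fi ← maximum (λ i → f (suc i)) zero | ℤ.≤-total (f zero) (f (suc i))
... | inj₁ f₀≤fi = suc i , λ { zero → f₀≤fi ; (suc j) → f≤fi j }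
... | inj₂ fi≤f₀ = zero , λ { zero → ℤ.≤-refl ; (suc j) → ℤ.≤-trans (f≤fi j) fi≤f₀ }

δ : ∀ {n} → Fin n → Fin n → ℤ
δ zero    zero    = 1ℤ
δ zero    (suc j) = 0ℤ
δ (suc i) zero    = 0ℤ
δ (suc i) (suc j) = δ i j

∑-δ : ∀ {n} i (t : Fin n → ℤ) → ∑[ j < n ] (δ i j * t j) ≡ t i
∑-δ zero    t = trans (cong₂ _+_ (ℤ.*-identityˡ (t zero)) (∑-0 {t = λ j → 0ℤ * t (suc j)} (λ _ → refl))) (ℤ.+-identityʳ (t zero))
∑-δ (suc i) t = trans (ℤ.+-identityˡ _) (∑-δ i (λ j → t (suc j)))

δ-sym : ∀ {n} (i j : Fin n) → δ i j ≡ δ j i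
δ-sym zero    zero    = refl
δ-sym zero    (suc j) = refl
δ-sym (suc i) zero    = refl
δ-sym (suc i) (suc j) = δ-sym i j

∑-δ′ : ∀ {n} i (t : Fin n → ℤ) → ∑[ j < n ] (t j * δ j i) ≡ t i
∑-δ′ i t = trans (sum-cong-≗ (λ j → trans (ℤ.*-comm (t j) (δ j i)) (cong (_* t j) (δ-sym j i)))) (∑-δ i t)

kernelVector : ∀ n (A : Fin n → Fin (suc n) → ℤ) →
               ∃ λ (y : Fin (suc n) → ℤ) → (∃ λ j → y j ≢ 0ℤ) × (∀ i → ∑[ j < suc n ] (A i j * y j) ≡ 0ℤ)
kernelVector zero    A = (λ _ → 1ℤ) , (zero , λ ()) , λ ()
kernelVector (suc n) A with Fin.any? (λ j → ¬? (A zero j ℤ.≟ 0ℤ))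
... | no A₀≗0 with y , (k , yk≢0) , Ay≡0 ← kernelVector n (λ i j → A (suc i) (suc j))
  = y⁺ , (suc k , yk≢0) , λ where
      zero    → ∑-0 (λ j → cong (_* y⁺ j) (decidable-stable (A zero j ℤ.≟ 0ℤ) (λ A₀j≢0 → A₀≗0 (j , A₀j≢0))))
      (suc i) → trans (cong₂ _+_ (ℤ.*-zeroʳ (A (suc i) zero)) (Ay≡0 i)) refl
  where
  y⁺ : Fin (suc (suc n)) → ℤ
  y⁺ zero    = 0ℤ
  y⁺ (suc j) = y j
... | yes (j , p≢0)
  with y , (k , yk≢0) , By≡0 ← kernelVector n (λ i l →
         A zero j * A (suc i) (punchIn j l) - A (suc i) j * A zero (punchIn j l))
  = y⁺ , (punchIn j k , y⁺-k≢0) , λ where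
      zero    → trans (row zero) (cancel p S₀)
      (suc i) → trans (row (suc i)) (trans (trans (rearrange p (A (suc i) j) S₀ (S (suc i)))
                  (sym (expand i))) (By≡0 i))
  where
  p : ℤ
  p = A zero j
  S : Fin (suc n) → ℤ
  S i = ∑[ l < suc n ] (A i (punchIn j l) * y l)
  S₀ : ℤ
  S₀ = S zero
  y⁺ : Fin (suc (suc n)) → ℤ
  y⁺ = insertAt (λ l → p * y l) j (- S₀)
  y⁺-k≢0 : y⁺ (punchIn j k) ≢ 0ℤ
  y⁺-k≢0 eq with ℤ.i*j≡0⇒i≡0∨j≡0 p (trans (sym (insertAt-punchIn (λ l → p * y l) j (- S₀) k)) eq)
  ... | inj₁ p≡0  = p≢0 p≡0
  ... | inj₂ yk≡0 = yk≢0 yk≡0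
  exchange : ∀ a p y → a * (p * y) ≡ p * (a * y)
  exchange = solve-∀
  row : ∀ i → ∑[ l < suc (suc n) ] (A i l * y⁺ l) ≡ A i j * (- S₀) + p * S i
  row i = begin
    ∑[ l < suc (suc n) ] (A i l * y⁺ l)
      ≡⟨ sum-remove {i = j} (λ l → A i l * y⁺ l) ⟩
    A i j * y⁺ j + ∑[ l < suc n ] (A i (punchIn j l) * y⁺ (punchIn j l))
      ≡⟨ cong₂ _+_ (cong (A i j *_) (insertAt-lookup (λ l → p * y l) j (- S₀)))
           (sum-cong-≗ (λ l → trans (cong (A i (punchIn j l) *_) (insertAt-punchIn (λ l → p * y l) j (- S₀) l))
             (exchange (A i (punchIn j l)) p (y l)))) ⟩
    A i j * (- S₀) + ∑[ l < suc n ] (p * (A i (punchIn j l) * y l))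
      ≡⟨ cong (λ x → A i j * (- S₀) + x) (∑-*ˡ p (λ l → A i (punchIn j l) * y l)) ⟩
    A i j * (- S₀) + p * S i ∎
    where open ≡-Reasoning
  cancel : ∀ p s → p * (- s) + p * s ≡ 0ℤ
  cancel = solve-∀
  rearrange : ∀ p a s t → a * (- s) + p * t ≡ p * t - a * s
  rearrange = solve-∀
  expand : ∀ i → ∑[ l < suc n ] ((p * A (suc i) (punchIn j l) - A (suc i) j * A zero (punchIn j l)) * y l)
               ≡ p * S (suc i) - A (suc i) j * S₀
  expand i = begin
    ∑[ l < suc n ] ((p * A (suc i) (punchIn j l) - A (suc i) j * A zero (punchIn j l)) * y l)
      ≡⟨ sum-cong-≗ (λ l → distrib p (A (suc i) (punchIn j l)) (A (suc i) j) (A zero (punchIn j l)) (y l)) ⟩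
    ∑[ l < suc n ] (p * (A (suc i) (punchIn j l) * y l) - A (suc i) j * (A zero (punchIn j l) * y l))
      ≡⟨ ∑-minus (λ l → p * (A (suc i) (punchIn j l) * y l)) (λ l → A (suc i) j * (A zero (punchIn j l) * y l)) ⟩
    ∑[ l < suc n ] (p * (A (suc i) (punchIn j l) * y l)) - ∑[ l < suc n ] (A (suc i) j * (A zero (punchIn j l) * y l))
      ≡⟨ cong₂ _-_ (∑-*ˡ p (λ l → A (suc i) (punchIn j l) * y l)) (∑-*ˡ (A (suc i) j) (λ l → A zero (punchIn j l) * y l)) ⟩
    p * S (suc i) - A (suc i) j * S₀ ∎
    where
    open ≡-Reasoning
    distrib : ∀ p a b c y → (p * a - b * c) * y ≡ p * (a * y) - b * (c * y)
    distrib = solve-∀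

commonMultiple : ∀ {n} (m : Fin n → ℕ) → (∀ i → NonZero (m i)) →
                 ∃ λ M → NonZero M × (∀ i → m i ℕ.∣ M)
commonMultiple {zero}  m m≢0 = 1 , _ , λ ()
commonMultiple {suc n} m m≢0 with M , M≢0 , m∣M ← commonMultiple (λ i → m (suc i)) (λ i → m≢0 (suc i))
  = m zero ℕ.* M , ℕ.m*n≢0 (m zero) M {{m≢0 zero}} {{M≢0}} ,
    λ { zero → ℕ.m∣m*n M ; (suc i) → ℕ.∣n⇒∣m*n (m zero) (m∣M i) }

module _ (G : Graph) where
  open Graph G

  root : Vertex
  root = fromℕ< nonempty

  div-+ : ∀ f g v → div (λ w → f w + g w) v ≡ div f v + div g v
  div-+ f g v = trans (sum-cong-≗ (λ w → lemma (+ edges v w) (f v) (g v) (f w) (g w)))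
    (∑-distrib-+ (λ w → + edges v w * (f v - f w)) (λ w → + edges v w * (g v - g w)))
    where
    lemma : ∀ m a b a′ b′ → m * (a + b - (a′ + b′)) ≡ m * (a - a′) + m * (b - b′)
    lemma = solve-∀

  div-* : ∀ k f v → div (λ w → k * f w) v ≡ k * div f v
  div-* k f v = trans (sum-cong-≗ (λ w → lemma k (+ edges v w) (f v) (f w)))
    (∑-*ˡ k (λ w → + edges v w * (f v - f w)))
    where
    lemma : ∀ k m a a′ → m * (k * a - k * a′) ≡ k * (m * (a - a′))
    lemma = solve-∀

  div-const : ∀ k v → div (λ _ → k) v ≡ 0ℤ
  div-const k v = ∑-0 (λ w → lemma (+ edges v w) k)
    where
    lemma : ∀ m k → m * (k - k) ≡ 0ℤ
    lemma = solve-∀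

  div-cong : ∀ {f g} → (∀ v → f v ≡ g v) → ∀ v → div f v ≡ div g v
  div-cong f≗g v = sum-cong-≗ (λ w → cong₂ (λ a b → + edges v w * (a - b)) (f≗g v) (f≗g w))

  div-∑ : ∀ {n} (k : Fin n → ℤ) (f : Fin n → Vertex → ℤ) v →
          div (λ w → ∑[ i < n ] (k i * f i w)) v ≡ ∑[ i < n ] (k i * div (f i) v)
  div-∑ {zero}  k f v = div-const 0ℤ v
  div-∑ {suc n} k f v = trans
    (div-+ (λ w → k zero * f zero w) (λ w → ∑[ i < n ] (k (suc i) * f (suc i) w)) v)
    (cong₂ _+_ (div-* (k zero) (f zero) v) (div-∑ (λ i → k (suc i)) (λ i → f (suc i)) v))

  div-selfAdjoint : ∀ f g → ∑[ v < order ] (g v * div f v) ≡ ∑[ v < order ] (f v * div g v)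
  div-selfAdjoint f g = begin
    ∑[ v < order ] (g v * div f v)
      ≡⟨ expand f g ⟩
    ∑[ v < order ] ∑[ w < order ] (+ edges v w * (g v * f v)) - ∑[ v < order ] ∑[ w < order ] (+ edges v w * (g v * f w))
      ≡⟨ cong₂ _-_ (sum-cong-≗ (λ v → sum-cong-≗ (λ w → cong (+ edges v w *_) (ℤ.*-comm (g v) (f v)))))
           (trans (∑-comm (λ v w → + edges v w * (g v * f w)))
             (sum-cong-≗ (λ v → sum-cong-≗ (λ w → cong₂ (λ m x → + m * x) (edges-sym w v) (ℤ.*-comm (g w) (f v)))))) ⟩
    ∑[ v < order ] ∑[ w < order ] (+ edges v w * (f v * g v)) - ∑[ v < order ] ∑[ w < order ] (+ edges v w * (f v * g w))
      ≡⟨ expand g f ⟨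
    ∑[ v < order ] (f v * div g v) ∎
    where
    open ≡-Reasoning
    lemma : ∀ a m b c → a * (m * (b - c)) ≡ m * (a * b) - m * (a * c)
    lemma = solve-∀
    expand : ∀ f g → ∑[ v < order ] (g v * div f v) ≡
      ∑[ v < order ] ∑[ w < order ] (+ edges v w * (g v * f v)) - ∑[ v < order ] ∑[ w < order ] (+ edges v w * (g v * f w))
    expand f g = trans
      (sum-cong-≗ (λ v → trans (*-distribˡ-sum (g v) (λ w → + edges v w * (f v - f w)))
        (trans (sum-cong-≗ (λ w → lemma (g v) (+ edges v w) (f v) (f w)))
          (∑-minus (λ w → + edges v w * (g v * f v)) (λ w → + edges v w * (g v * f w))))))
      (∑-minus (λ v → ∑[ w < order ] (+ edges v w * (g v * f v))) (λ v → ∑[ w < order ] (+ edges v w * (g v * f w))))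

  degree-div : ∀ f → degree (div f) ≡ 0ℤ
  degree-div f = begin
    ∑[ v < order ] div f v                   ≡⟨ sum-cong-≗ (λ v → ℤ.*-identityˡ (div f v)) ⟨
    ∑[ v < order ] (1ℤ * div f v)            ≡⟨ div-selfAdjoint f (λ _ → 1ℤ) ⟩
    ∑[ v < order ] (f v * div (λ _ → 1ℤ) v)  ≡⟨ ∑-0 (λ v → trans (cong (f v *_) (div-const 1ℤ v)) (ℤ.*-zeroʳ (f v))) ⟩
    0ℤ                                       ∎
    where open ≡-Reasoning

  harmonic⇒constant : ∀ f → (∀ v → div f v ≡ 0ℤ) → ∀ v → f v ≡ f root
  harmonic⇒constant f div≡0 v = trans (f≡max v) (sym (f≡max root))
    where
    u : Vertex
    u = proj₁ (maximum f root)
    f≤fu : ∀ w → f w ≤ f u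
    f≤fu = proj₂ (maximum f root)

    neighbour : ∀ {x y} → f x ≡ f u → 0 ℕ.< edges x y → f y ≡ f u
    neighbour {x} {y} fx≡fu 0<xy
      with ℤ.i*j≡0⇒i≡0∨j≡0 (+ edges x y) (∑-nonneg-0 (λ w → + edges x w * (f x - f w))
             (λ w → subst (_≤ + edges x w * (f x - f w)) (ℤ.*-zeroʳ (+ edges x w))
               (ℤ.*-monoˡ-≤-nonNeg (+ edges x w) (ℤ.i≤j⇒0≤j-i (subst (f w ≤_) (sym fx≡fu) (f≤fu w)))))
             (div≡0 x) y)
    ... | inj₁ xy≡0    = contradiction (sym (ℤ.+-injective xy≡0)) (ℕ.<⇒≢ 0<xy)
    ... | inj₂ fx-fy≡0 = trans (sym (ℤ.i-j≡0⇒i≡j (f x) (f y) fx-fy≡0)) fx≡fu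

    along : ∀ {x y} → f x ≡ f u → Star (λ x y → 0 ℕ.< edges x y) x y → f y ≡ f u
    along fx≡fu ε             = fx≡fu
    along fx≡fu (0<xy ◅ path) = along (neighbour fx≡fu 0<xy) path

    f≡max : ∀ w → f w ≡ f u
    f≡max w = along refl (connected u w)

  Div⁰ : AbelianGroup 0ℓ 0ℓ
  Div⁰ = record
    { Carrier = ∃ λ (D : Divisor) → degree D ≡ 0ℤ
    ; _≈_     = λ (D , _) (E , _) → ∀ v → D v ≡ E v
    ; _∙_     = λ (D , D≡0) (E , E≡0) → (λ v → D v + E v) ,
        trans (∑-distrib-+ D E) (cong₂ _+_ D≡0 E≡0)
    ; ε       = (λ _ → 0ℤ) , ∑-0 (λ (_ : Vertex) → refl)
    ; _⁻¹     = λ (D , D≡0) → (λ v → - D v) , trans (∑-neg D) (cong -_ D≡0)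
    ; isAbelianGroup = record
      { isGroup = record
        { isMonoid = record
          { isSemigroup = record
            { isMagma = record
              { isEquivalence = record
                { refl  = λ v → refl
                ; sym   = λ D≗E v → sym (D≗E v)
                ; trans = λ D≗E E≗F v → trans (D≗E v) (E≗F v)
                }
              ; ∙-cong = λ D≗D′ E≗E′ v → cong₂ _+_ (D≗D′ v) (E≗E′ v)
              }
            ; assoc = λ (D , _) (E , _) (F , _) v → ℤ.+-assoc (D v) (E v) (F v)
            }
          ; identity = (λ (D , _) v → ℤ.+-identityˡ (D v)) , (λ (D , _) v → ℤ.+-identityʳ (D v))
          }
        ; inverse = (λ (D , _) v → ℤ.+-inverseˡ (D v)) , (λ (D , _) v → ℤ.+-inverseʳ (D v))
        ; ⁻¹-cong = λ D≗E v → cong -_ (D≗E v)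
        }
      ; comm = λ (D , _) (E , _) v → ℤ.+-comm (D v) (E v)
      }
    }

  Principal : Subgroup Div⁰ 0ℓ
  Principal = record
    { Member    = λ (D , _) → ∃ λ (f : Vertex → ℤ) → ∀ v → D v ≡ div f v
    ; resp      = λ D≗E (f , D≗div-f) → f , λ v → trans (sym (D≗E v)) (D≗div-f v)
    ; 0#-member = (λ _ → 0ℤ) , λ v → sym (div-const 0ℤ v)
    ; ∙-closed  = λ (f , D≗div-f) (g , E≗div-g) → (λ v → f v + g v) ,
        λ v → trans (cong₂ _+_ (D≗div-f v) (E≗div-g v)) (sym (div-+ f g v))
    ; ⁻¹-closed = λ (f , D≗div-f) → (λ v → - 1ℤ * f v) ,
        λ v → trans (cong -_ (D≗div-f v)) (trans (sym (ℤ.-1*i≡-i (div f v))) (sym (div-* (- 1ℤ) f v)))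
    }

  JacGroup : AbelianGroup 0ℓ 0ℓ
  JacGroup = Quotient Div⁰ Principal

  -- The data m and f entering the definition of ⟨ D , - ⟩.
  record Potential (D : Divisor) : Set where
    field
      m         : ℕ
      {{m≢0}}   : NonZero m
      f         : Vertex → ℤ
      div-f≡m*D : ∀ v → div f v ≡ + m * D v

  -- Opaque because the choice is immaterial: see monodromy-unique.
  opaque
    potential : ∀ D → degree D ≡ 0ℤ → Potential D
    potential D D≡0 with y , (j , yj≢0) , Ay≡0 ← kernelVector order (λ v → λ where
        zero    → - D v
        (suc w) → div (δ w) v + δ root v * δ root w)
      = fromSolution (y zero) refl
      where
      f : Vertex → ℤ
      f w = y (suc w)

      div-δ : ∀ v → ∑[ w < order ] ((div (δ w) v + δ root v * δ root w) * f w) ≡ div f v + δ root v * f root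
      div-δ v = begin
        ∑[ w < order ] ((div (δ w) v + δ root v * δ root w) * f w)
          ≡⟨ sum-cong-≗ (λ w → lemma (div (δ w) v) (δ root v) (δ root w) (f w)) ⟩
        ∑[ w < order ] (f w * div (δ w) v + δ root v * (δ root w * f w))
          ≡⟨ ∑-distrib-+ (λ w → f w * div (δ w) v) (λ w → δ root v * (δ root w * f w)) ⟩
        ∑[ w < order ] (f w * div (δ w) v) + ∑[ w < order ] (δ root v * (δ root w * f w))
          ≡⟨ cong₂ _+_
               (trans (sym (div-∑ f δ v)) (div-cong (λ u → ∑-δ′ u f) v))
               (trans (∑-*ˡ (δ root v) (λ w → δ root w * f w)) (cong (δ root v *_) (∑-δ root f))) ⟩
        div f v + δ root v * f root ∎
        where
        open ≡-Reasoning
        lemma : ∀ d a b x → (d + a * b) * x ≡ x * d + a * (b * x)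
        lemma = solve-∀

      equation : ∀ v → div f v + δ root v * f root ≡ y zero * D v
      equation v = trans (lemma (D v) (y zero) _)
        (trans (cong (λ x → x + y zero * D v) (trans (cong (λ x → - D v * y zero + x) (sym (div-δ v))) (Ay≡0 v)))
          (ℤ.+-identityˡ (y zero * D v)))
        where
        lemma : ∀ d m x → x ≡ - d * m + x + m * d
        lemma = solve-∀

      f-root≡0 : f root ≡ 0ℤ
      f-root≡0 = begin
        f root                                           ≡⟨ ∑-δ root (λ _ → f root) ⟨
        ∑[ v < order ] (δ root v * f root)               ≡⟨ ℤ.+-identityˡ _ ⟨
        0ℤ + ∑[ v < order ] (δ root v * f root)          ≡⟨ cong (λ x → x + ∑[ v < order ] (δ root v * f root)) (degree-div f) ⟨
        degree (div f) + ∑[ v < order ] (δ root v * f root) ≡⟨ ∑-distrib-+ (div f) (λ v → δ root v * f root) ⟨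
        ∑[ v < order ] (div f v + δ root v * f root)     ≡⟨ sum-cong-≗ equation ⟩
        ∑[ v < order ] (y zero * D v)                    ≡⟨ ∑-*ˡ (y zero) D ⟩
        y zero * degree D                                ≡⟨ cong (y zero *_) D≡0 ⟩
        y zero * 0ℤ                                      ≡⟨ ℤ.*-zeroʳ (y zero) ⟩
        0ℤ                                               ∎
        where open ≡-Reasoning

      div-f : ∀ v → div f v ≡ y zero * D v
      div-f v = begin
        div f v                      ≡⟨ ℤ.+-identityʳ (div f v) ⟨
        div f v + 0ℤ                 ≡⟨ cong (λ x → div f v + x) (ℤ.*-zeroʳ (δ root v)) ⟨
        div f v + δ root v * 0ℤ      ≡⟨ cong (λ x → div f v + δ root v * x) f-root≡0 ⟨
        div f v + δ root v * f root  ≡⟨ equation v ⟩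
        y zero * D v                 ∎
        where open ≡-Reasoning

      fromSolution : ∀ m → y zero ≡ m → Potential D
      fromSolution (+ zero) m≡0 = contradiction (y≗0 j) yj≢0
        where
        y≗0 : ∀ j → y j ≡ 0ℤ
        y≗0 zero    = m≡0
        y≗0 (suc w) = trans (harmonic⇒constant f (λ v → trans (div-f v) (cong (_* D v) m≡0)) w) f-root≡0
      fromSolution (+ suc k) m≡k = record
        { m = suc k ; f = f ; div-f≡m*D = λ v → trans (div-f v) (cong (_* D v) m≡k) }
      fromSolution -[1+ k ] m≡-k = record
        { m = suc k
        ; f = λ v → - 1ℤ * f v
        ; div-f≡m*D = λ v → begin
            div (λ w → - 1ℤ * f w) v   ≡⟨ div-* (- 1ℤ) f v ⟩
            - 1ℤ * div f v             ≡⟨ cong (- 1ℤ *_) (trans (div-f v) (cong (_* D v) m≡-k)) ⟩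
            - 1ℤ * (- (+ suc k) * D v) ≡⟨ lemma (+ suc k) (D v) ⟩
            + suc k * D v              ∎
        }
        where
        open ≡-Reasoning
        lemma : ∀ k d → - 1ℤ * (- k * d) ≡ k * d
        lemma = solve-∀

  monodromy : ∀ {D₁} → Potential D₁ → Divisor → ℚᵘ
  monodromy P D₂ = (∑[ v < order ] (D₂ v * f v)) / m
    where open Potential P

  monodromy-sym : ∀ {D₁ D₂} (P₁ : Potential D₁) (P₂ : Potential D₂) →
                  monodromy P₁ D₂ ≃ monodromy P₂ D₁
  monodromy-sym {D₁} {D₂} P₁ P₂ = /-≃ _ _ P₁.m P₂.m (begin
    (∑[ v < order ] (D₂ v * P₁.f v)) * + P₂.m  ≡⟨ scale D₂ P₂ P₁.f ⟩
    ∑[ v < order ] (P₁.f v * div P₂.f v)       ≡⟨ div-selfAdjoint P₂.f P₁.f ⟩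
    ∑[ v < order ] (P₂.f v * div P₁.f v)       ≡⟨ scale D₁ P₁ P₂.f ⟨
    (∑[ v < order ] (D₁ v * P₂.f v)) * + P₁.m  ∎)
    where
    open ≡-Reasoning
    module P₁ = Potential P₁
    module P₂ = Potential P₂
    lemma : ∀ m d x → m * (d * x) ≡ x * (m * d)
    lemma = solve-∀
    scale : ∀ D (P : Potential D) g → (∑[ v < order ] (D v * g v)) * + Potential.m P
                                    ≡ ∑[ v < order ] (g v * div (Potential.f P) v)
    scale D P g = trans (ℤ.*-comm _ (+ Potential.m P)) (trans (*-distribˡ-sum (+ Potential.m P) (λ v → D v * g v))
      (sum-cong-≗ (λ v → trans (lemma (+ Potential.m P) (D v) (g v)) (cong (g v *_) (sym (Potential.div-f≡m*D P v))))))

  -- The value of the pairing does not depend on the choice of m and f.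
  monodromy-unique : ∀ {D₁} (P P′ : Potential D₁) D₂ → degree D₂ ≡ 0ℤ →
                     monodromy P D₂ ≃ monodromy P′ D₂
  monodromy-unique P P′ D₂ D₂≡0 =
    ℚᵘ.≃-trans (monodromy-sym P P₂) (ℚᵘ.≃-sym (monodromy-sym P′ P₂))
    where
    P₂ : Potential D₂
    P₂ = potential D₂ D₂≡0

  monodromy-+ : ∀ {D} (P : Potential D) E F →
                monodromy P (λ v → E v + F v) ≃ monodromy P E ℚᵘ.+ monodromy P F
  monodromy-+ P E F = ℚᵘ.≃-trans
    (/-≃ _ _ m m (cong (_* + m) (trans
      (sum-cong-≗ (λ v → ℤ.*-distribʳ-+ (f v) (E v) (F v)))
      (∑-distrib-+ (λ v → E v * f v) (λ v → F v * f v)))))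
    (/-+ (∑[ v < order ] (E v * f v)) (∑[ v < order ] (F v * f v)) m)
    where open Potential P

  monodromy-0 : ∀ {D} (P : Potential D) → monodromy P (λ _ → 0ℤ) ≃ 0ℚᵘ
  monodromy-0 P = /-≃ (∑[ v < order ] (0ℤ * f v)) 0ℤ m 1 (cong (_* 1ℤ) (∑-0 (λ (_ : Vertex) → refl)))
    where open Potential P

  monodromy-cong : ∀ {D} (P : Potential D) E F g → (∀ v → E v - F v ≡ div g v) →
                   monodromy P E ℚ/ℤ.≈ monodromy P F
  monodromy-cong {D} P E F g E-F≡div-g = /-≈-intro e f′ m m (∑[ v < order ] (D v * g v)) (begin
      e * + m - f′ * + m
        ≡⟨ factor e f′ (+ m) ⟩
      (e - f′) * + m
        ≡⟨ cong (_* + m) (∑-minus (λ v → E v * f v) (λ v → F v * f v)) ⟨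
      (∑[ v < order ] (E v * f v - F v * f v)) * + m
        ≡⟨ cong (_* + m) (sum-cong-≗ (λ v → trans (collect (E v) (F v) (f v)) (cong (f v *_) (E-F≡div-g v)))) ⟩
      (∑[ v < order ] (f v * div g v)) * + m
        ≡⟨ cong (_* + m) (div-selfAdjoint g f) ⟩
      (∑[ v < order ] (g v * div f v)) * + m
        ≡⟨ cong (_* + m) (trans (sum-cong-≗ (λ v → trans (cong (g v *_) (div-f≡m*D v)) (exchange (g v) (+ m) (D v))))
             (∑-*ˡ (+ m) (λ v → D v * g v))) ⟩
      + m * (∑[ v < order ] (D v * g v)) * + m
        ≡⟨ reorder (+ m) (∑[ v < order ] (D v * g v)) ⟩
      (∑[ v < order ] (D v * g v)) * (+ m * + m) ∎)
    where
    open ≡-Reasoning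
    open Potential P
    e f′ : ℤ
    e = ∑[ v < order ] (E v * f v)
    f′ = ∑[ v < order ] (F v * f v)
    factor : ∀ a b m → a * m - b * m ≡ (a - b) * m
    factor = solve-∀
    collect : ∀ a b x → a * x - b * x ≡ x * (a - b)
    collect = solve-∀
    exchange : ∀ g m d → g * (m * d) ≡ m * (d * g)
    exchange = solve-∀
    reorder : ∀ m s → m * s * m ≡ s * (m * m)
    reorder = solve-∀

  point : Vertex → Divisor
  point v w = δ w v - δ w root

  degree-point : ∀ v → degree (point v) ≡ 0ℤ
  degree-point v = trans (∑-minus (λ w → δ w v) (λ w → δ w root))
    (trans (cong₂ _-_ (∑δ≡1 v) (∑δ≡1 root)) refl)
    where
    ∑δ≡1 : ∀ u → ∑[ w < order ] δ w u ≡ 1ℤ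
    ∑δ≡1 u = trans (sum-cong-≗ (λ w → sym (ℤ.*-identityˡ (δ w u)))) (∑-δ′ u (λ _ → 1ℤ))

  monodromy-point : ∀ {D} (P : Potential D) v → let open Potential P in
                    monodromy P (point v) ≡ (f v - f root) / m
  monodromy-point P v = cong (λ x → x / m) (begin
    ∑[ w < order ] ((δ w v - δ w root) * f w)           ≡⟨ sum-cong-≗ (λ w → lemma (δ w v) (δ w root) (f w)) ⟩
    ∑[ w < order ] (f w * δ w v - f w * δ w root)       ≡⟨ ∑-minus (λ w → f w * δ w v) (λ w → f w * δ w root) ⟩
    ∑[ w < order ] (f w * δ w v) - ∑[ w < order ] (f w * δ w root) ≡⟨ cong₂ _-_ (∑-δ′ v f) (∑-δ′ root f) ⟩
    f v - f root                                        ∎)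
    where
    open ≡-Reasoning
    open Potential P
    lemma : ∀ a b x → (a - b) * x ≡ x * a - x * b
    lemma = solve-∀

  constant⇒principal : ∀ {D} (P : Potential D) → let open Potential P in
    (∀ v → + m ∣ f v - f root) → ∃ λ g → ∀ v → D v ≡ div g v
  constant⇒principal {D} P m∣f = g , λ v → ℤ.*-cancelˡ-≡ (+ m) (D v) (div g v) (begin
    + m * D v                              ≡⟨ div-f≡m*D v ⟨
    div f v                                ≡⟨ div-cong (λ w → trans (lemma (f w) (f root)) (cong (λ x → x + f root)
                                                (trans (_∣_.equality (m∣f w)) (ℤ.*-comm (g w) (+ m))))) v ⟩
    div (λ w → + m * g w + f root) v       ≡⟨ div-+ (λ w → + m * g w) (λ _ → f root) v ⟩
    div (λ w → + m * g w) v + div (λ _ → f root) v ≡⟨ cong₂ _+_ (div-* (+ m) g v) (div-const (f root) v) ⟩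
    + m * div g v + 0ℤ                     ≡⟨ ℤ.+-identityʳ _ ⟩
    + m * div g v                          ∎)
    where
    open ≡-Reasoning
    open Potential P
    g : Vertex → ℤ
    g v = _∣_.quotient (m∣f v)
    lemma : ∀ a b → a ≡ a - b + b
    lemma = solve-∀

  orthogonal⇒principal : ∀ {D} (P : Potential D) →
    (∀ v → monodromy P (point v) ℚ/ℤ.≈ 0ℚᵘ) → ∃ λ g → ∀ v → D v ≡ div g v
  orthogonal⇒principal P P⊥ = constant⇒principal P (λ v →
    /-≈0-elim (f v - f root) m (subst (ℚ/ℤ._≈ 0ℚᵘ) (monodromy-point P v) (P⊥ v)))
    where open Potential P

  principal⇒constant : ∀ {D} (P : Potential D) → let open Potential P in
    (∃ λ g → ∀ v → D v ≡ div g v) → ∀ v → + m ∣ f v - f root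
  principal⇒constant {D} P (g , D≡div-g) v = /-≈0-elim (f v - f root) m
    (subst (ℚ/ℤ._≈ 0ℚᵘ) (monodromy-point P v)
      (ℚ/ℤ.trans {monodromy P (point v)} {monodromy Q D} {0ℚᵘ} (≃⇒≈ (monodromy-sym P Q))
        (ℚ/ℤ.trans {monodromy Q D} {monodromy Q (λ _ → 0ℤ)} {0ℚᵘ}
          (monodromy-cong Q D (λ _ → 0ℤ) g (λ w → trans (ℤ.+-identityʳ (D w)) (D≡div-g w)))
          (≃⇒≈ (monodromy-0 Q)))))
    where
    open Potential P
    Q : Potential (point v)
    Q = potential (point v) (degree-point v)

  principal? : ∀ D → degree D ≡ 0ℤ → Dec (∃ λ g → ∀ v → D v ≡ div g v)
  principal? D D≡0 = map′ (constant⇒principal P) (principal⇒constant P)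
    (Fin.all? (λ v → + m ∣? (f v - f root)))
    where
    P : Potential D
    P = potential D D≡0
    open Potential P

  monodromyPairing : Pairing JacGroup
  monodromyPairing = record
    { ⟨_,_⟩     = ⟨_,_⟩
    ; ⟨⟩-cong   = λ {D} {D′} {E} {E′} D∼D′ E∼E′ →
        ℚ/ℤ.trans {⟨ D , E ⟩} {⟨ D , E′ ⟩} {⟨ D′ , E′ ⟩} (congʳ D E E′ E∼E′)
        (ℚ/ℤ.trans {⟨ D , E′ ⟩} {⟨ E′ , D ⟩} {⟨ D′ , E′ ⟩} (≃⇒≈ (⟨⟩-sym D E′))
        (ℚ/ℤ.trans {⟨ E′ , D ⟩} {⟨ E′ , D′ ⟩} {⟨ D′ , E′ ⟩} (congʳ E′ D D′ D∼D′) (≃⇒≈ (⟨⟩-sym E′ D′))))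
    ; symmetric = λ D E → ≃⇒≈ (⟨⟩-sym D E)
    ; additiveˡ = λ D D′ E → ≃⇒≈ (ℚᵘ.≃-trans (⟨⟩-sym (D ∙ D′) E)
        (ℚᵘ.≃-trans (monodromy-+ (potentialOf E) (proj₁ D) (proj₁ D′))
          (ℚᵘ.+-cong (⟨⟩-sym E D) (⟨⟩-sym E D′))))
    ; additiveʳ = λ D (E , _) (E′ , _) → ≃⇒≈ (monodromy-+ (potentialOf D) E E′)
    ; nondegenerate = λ D D⊥ → Subgroup.resp Principal {D} {D ∙ 0# ⁻¹}
        (λ v → sym (ℤ.+-identityʳ (proj₁ D v)))
        (orthogonal⇒principal (potentialOf D) (λ v → D⊥ (point v , degree-point v)))
    }
    where
    open AbelianGroup Div⁰ using (Carrier; _∙_; _⁻¹) renaming (ε to 0#)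

    potentialOf : (D : Carrier) → Potential (proj₁ D)
    potentialOf (D , D≡0) = potential D D≡0

    ⟨_,_⟩ : Carrier → Carrier → ℚᵘ
    ⟨ D , E ⟩ = monodromy (potentialOf D) (proj₁ E)

    ⟨⟩-sym : ∀ D E → ⟨ D , E ⟩ ≃ ⟨ E , D ⟩
    ⟨⟩-sym D E = monodromy-sym (potentialOf D) (potentialOf E)

    congʳ : ∀ D E E′ → AbelianGroup._≈_ JacGroup E E′ → ⟨ D , E ⟩ ℚ/ℤ.≈ ⟨ D , E′ ⟩
    congʳ D (E , _) (E′ , _) (g , E-E′≡div-g) = monodromy-cong (potentialOf D) E E′ g E-E′≡div-g

  exponent : ∃ λ M → NonZero M ×
             (∀ E → degree E ≡ 0ℤ → ∃ λ g → ∀ w → + M * E w ≡ div g w)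
  exponent = M , proj₁ (proj₂ common) , λ E E≡0 → g E , λ w → begin
      + M * E w
        ≡⟨ cong (+ M *_) (E≡∑ E E≡0 w) ⟩
      + M * ∑[ v < order ] (E v * point v w)
        ≡⟨ *-distribˡ-sum (+ M) (λ v → E v * point v w) ⟩
      ∑[ v < order ] (+ M * (E v * point v w))
        ≡⟨ sum-cong-≗ (λ v → trans (cong (_* (E v * point v w)) (M≡k*m v)) (regroup (k v) (+ m v) (E v) (point v w))) ⟩
      ∑[ v < order ] (E v * k v * (+ m v * point v w))
        ≡⟨ sum-cong-≗ (λ v → cong (E v * k v *_) (Potential.div-f≡m*D (P v) w)) ⟨
      ∑[ v < order ] (E v * k v * div (f v) w)
        ≡⟨ div-∑ (λ v → E v * k v) f w ⟨
      div (g E) w ∎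
    where
    open ≡-Reasoning
    P : ∀ v → Potential (point v)
    P v = potential (point v) (degree-point v)
    m : Vertex → ℕ
    m v = Potential.m (P v)
    f : Vertex → Vertex → ℤ
    f v = Potential.f (P v)
    common : ∃ λ M → NonZero M × (∀ v → m v ℕ.∣ M)
    common = commonMultiple m (λ v → Potential.m≢0 (P v))
    M : ℕ
    M = proj₁ common
    k : Vertex → ℤ
    k v = + ℕ._∣_.quotient (proj₂ (proj₂ common) v)
    M≡k*m : ∀ v → + M ≡ k v * + m v
    M≡k*m v = trans (cong +_ (ℕ._∣_.equality (proj₂ (proj₂ common) v))) (ℤ.pos-* (ℕ._∣_.quotient (proj₂ (proj₂ common) v)) (m v))
    g : Divisor → Vertex → ℤ
    g E w = ∑[ v < order ] (E v * k v * f v w)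
    regroup : ∀ c m e p → c * m * (e * p) ≡ e * c * (m * p)
    regroup = solve-∀
    distrib : ∀ e a b → e * (a - b) ≡ a * e - b * e
    distrib = solve-∀
    E≡∑ : ∀ E → degree E ≡ 0ℤ → ∀ w → E w ≡ ∑[ v < order ] (E v * point v w)
    E≡∑ E E≡0 w = sym (begin
      ∑[ v < order ] (E v * (δ w v - δ w root))        ≡⟨ sum-cong-≗ (λ v → distrib (E v) (δ w v) (δ w root)) ⟩
      ∑[ v < order ] (δ w v * E v - δ w root * E v)    ≡⟨ ∑-minus (λ v → δ w v * E v) (λ v → δ w root * E v) ⟩
      ∑[ v < order ] (δ w v * E v) - ∑[ v < order ] (δ w root * E v) ≡⟨ cong₂ _-_ (∑-δ w E) (∑-*ˡ (δ w root) E) ⟩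
      E w - δ w root * degree E                        ≡⟨ cong (λ x → E w - δ w root * x) E≡0 ⟩
      E w - δ w root * 0ℤ                              ≡⟨ cong (λ x → E w - x) (ℤ.*-zeroʳ (δ w root)) ⟩
      E w - 0ℤ                                         ≡⟨ ℤ.+-identityʳ (E w) ⟩
      E w                                              ∎)

  normalise : Divisor → Divisor
  normalise F w = F w - degree F * δ w root

  degree-normalise : ∀ F → degree (normalise F) ≡ 0ℤ
  degree-normalise F = begin
    ∑[ w < order ] (F w - degree F * δ w root)           ≡⟨ ∑-minus F (λ w → degree F * δ w root) ⟩
    degree F - ∑[ w < order ] (degree F * δ w root)      ≡⟨ cong (λ x → degree F - x) (∑-δ′ root (λ _ → degree F)) ⟩
    degree F - degree F                                  ≡⟨ ℤ.+-inverseʳ (degree F) ⟩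
    0ℤ                                                   ∎
    where open ≡-Reasoning

  Jac-finite : Finite (AbelianGroup.setoid JacGroup)
  Jac-finite = enumerated⇒finite
    (record { isDecEquivalence = record
      { isEquivalence = AbelianGroup.isEquivalence JacGroup
      ; _≟_           = λ D E → let (F , F≡0) = AbelianGroup._-_ Div⁰ D E in principal? F F≡0 } })
    (λ i → normalise (residue i) , degree-normalise (residue i))
    (λ (D , D≡0) → code D ,
      (let g , M*E≡div-g = proj₂ (proj₂ exponent) (normalise (quot D)) (degree-normalise (quot D))
       in g , λ w → trans (difference D D≡0 w) (M*E≡div-g w)))
    where
    open ≡-Reasoning
    M : ℕ
    M = proj₁ exponent
    instance
      M≢0 : NonZero M
      M≢0 = proj₁ (proj₂ exponent)
    residue : Fin (M ^ order) → Divisor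
    residue i w = + toℕ (finToFun i w)
    quot : Divisor → Divisor
    quot D w = D w ℤ./ℕ M
    code : Divisor → Fin (M ^ order)
    code D = funToFin (λ w → fromℕ< (ℤ.n%ℕd<d (D w) M))
    D≡R+QM : ∀ D w → D w ≡ residue (code D) w + + M * quot D w
    D≡R+QM D w = trans (ℤ.a≡a%ℕn+[a/ℕn]*n (D w) M) (cong₂ _+_
      (cong +_ (sym (trans (cong toℕ (Fin.finToFun-funToFin _ w)) (Fin.toℕ-fromℕ< (ℤ.n%ℕd<d (D w) M)))))
      (ℤ.*-comm (quot D w) (+ M)))
    degree-D : ∀ D → degree D ≡ degree (residue (code D)) + + M * degree (quot D)
    degree-D D = trans (sum-cong-≗ (D≡R+QM D)) (trans
      (∑-distrib-+ (residue (code D)) (λ w → + M * quot D w))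
      (cong (λ x → degree (residue (code D)) + x) (∑-*ˡ (+ M) (quot D))))
    lemma : ∀ r m q s t d → r + m * q - (r - s * d) ≡ m * (q - t * d) + (s + m * t) * d
    lemma = solve-∀
    difference : ∀ D → degree D ≡ 0ℤ → ∀ w →
                 D w - normalise (residue (code D)) w ≡ + M * normalise (quot D) w
    difference D D≡0 w = begin
      D w - normalise R w                     ≡⟨ cong (λ x → x - normalise R w) (D≡R+QM D w) ⟩
      R w + + M * Q w - normalise R w         ≡⟨ lemma (R w) (+ M) (Q w) (degree R) (degree Q) (δ w root) ⟩
      + M * normalise Q w + (degree R + + M * degree Q) * δ w root
                                              ≡⟨ cong (λ x → + M * normalise Q w + x * δ w root) (trans (sym (degree-D D)) D≡0) ⟩
      + M * normalise Q w + 0ℤ                ≡⟨ ℤ.+-identityʳ _ ⟩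
      + M * normalise Q w                     ∎
      where
      R Q : Divisor
      R = residue (code D)
      Q = quot D

Jac : Graph → GroupWithPairing 0ℓ 0ℓ
Jac G = record
  { abelianGroup = JacGroup G
  ; finite       = Jac-finite G
  ; pairing      = monodromyPairing G
  }

{-# OPTIONS --safe #-}

-- An electrical network made of unit resistors between two terminals, of
-- effective resistance p / q, whose Jacobian is cyclic of order q generated by
-- the difference of the terminals, has Jacobian ℤ/q with the pairing p x y / q.
-- Prolonging the network by one resistor in series turns p / q into p / q + 1,
-- and adding a resistor in parallel turns q / p into q / p + 1.  By the
-- subtractive Euclidean algorithm every fraction in lowest terms is reached.
module Submission where

import Algebra.Morphism.Construct.Composition as Composition
open import Algebra.Bundles using (AbelianGroup)
import Algebra.Properties.Semiring.Sum as Sum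
open import Data.Fin.Base using (Fin; zero; suc)
open import Data.Integer.Base using (ℤ; +_; 0ℤ; 1ℤ; -_; _+_; _-_; _*_; ∣_∣)
open import Data.Integer.Divisibility.Signed using (_∣_; divides; ∣⇒∣ᵤ; ∣ᵤ⇒∣; ∣m∣n⇒∣m-n; ∣-trans)
import Data.Integer.DivMod as ℤ
import Data.Integer.Properties as ℤ
open import Data.Integer.Tactic.RingSolver using (solve-∀)
import Data.Nat.Base as ℕ
open import Data.Nat.Base using (ℕ; zero; suc; NonZero; _≥_; _^_; less; equal; greater)
open import Data.Nat.Coprimality as ℕ using (Coprime)
import Data.Nat.Divisibility as ℕ
open import Data.Nat.Induction using (Acc; acc; <-wellFounded)
import Data.Nat.Properties as ℕ
open import Data.Product.Base using (∃; _×_; _,_)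
open import Data.Rational.Unnormalised.Base using (_/_)
open import Level using (0ℓ)
open import Relation.Binary.Construct.Closure.ReflexiveTransitive using (Star; ε; _◅_; _◅◅_; gmap; map)
open import Relation.Binary.PropositionalEquality
  using (_≡_; _≢_; refl; sym; trans; cong; cong₂; subst; module ≡-Reasoning)
open import Relation.Nullary using (contradiction)
open import Relation.Nullary.Decidable using (False; toWitnessFalse)
open import Defs

open Sum ℤ.+-*-semiring using (sum-syntax; ∑-distrib-+; sum-cong-≗)

-- Composition of isomorphisms, and the Kronecker delta as an edge count.

≅-trans : ∀ {a b c ℓ₁ ℓ₂ ℓ₃} {Γ : GroupWithPairing a ℓ₁} {Δ : GroupWithPairing b ℓ₂}
          {Θ : GroupWithPairing c ℓ₃} → Γ ≅ Δ → Δ ≅ Θ → Γ ≅ Θ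
≅-trans {Γ = Γ} {Δ} {Θ} φ ψ = record
  { to                 = λ x → ψ.to (φ.to x)
  ; isGroupIsomorphism = Composition.isGroupIsomorphism Θ.trans
      φ.isGroupIsomorphism ψ.isGroupIsomorphism
  ; preserves-⟨⟩       = λ x y →
      ℚ/ℤ.trans {Θ.⟨ ψ.to (φ.to x) , ψ.to (φ.to y) ⟩} {Δ.⟨ φ.to x , φ.to y ⟩} {Γ.⟨ x , y ⟩}
        (ψ.preserves-⟨⟩ (φ.to x) (φ.to y)) (φ.preserves-⟨⟩ x y)
  }
  where
  module Γ = GroupWithPairing Γ
  module Δ = GroupWithPairing Δ
  module Θ = GroupWithPairing Θ
  module φ = _≅_ φ
  module ψ = _≅_ ψ

-- Since `δ` takes only the values 0 and 1, `∣ δ i j ∣` can serve as a number of edges, which has to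
-- be natural.
+∣δ∣≡δ : ∀ {n} (i j : Fin n) → + ∣ δ i j ∣ ≡ δ i j
+∣δ∣≡δ zero    zero    = refl
+∣δ∣≡δ zero    (suc j) = refl
+∣δ∣≡δ (suc i) zero    = refl
+∣δ∣≡δ (suc i) (suc j) = +∣δ∣≡δ i j

0<∣δ∣ : ∀ {n} (i : Fin n) → 0 ℕ.< ∣ δ i i ∣
0<∣δ∣ zero    = ℕ.s≤s ℕ.z≤n
0<∣δ∣ (suc i) = 0<∣δ∣ i

-- An edge added between two distinct vertices is not a loop; this is where `addEdge` needs `s ≢ g`.
∣δ∣*∣δ∣≡0 : ∀ {n} {i j : Fin n} → i ≢ j → ∀ k → ∣ δ i k ∣ ℕ.* ∣ δ j k ∣ ≡ 0
∣δ∣*∣δ∣≡0 {i = zero}  {zero}  i≢j k       = contradiction refl i≢j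
∣δ∣*∣δ∣≡0 {i = zero}  {suc j} i≢j zero    = refl
∣δ∣*∣δ∣≡0 {i = zero}  {suc j} i≢j (suc k) = refl
∣δ∣*∣δ∣≡0 {i = suc i} {zero}  i≢j zero    = refl
∣δ∣*∣δ∣≡0 {i = suc i} {zero}  i≢j (suc k) = ℕ.*-zeroʳ ∣ δ i k ∣
∣δ∣*∣δ∣≡0 {i = suc i} {suc j} i≢j zero    = refl
∣δ∣*∣δ∣≡0 {i = suc i} {suc j} i≢j (suc k) = ∣δ∣*∣δ∣≡0 (λ i≡j → i≢j (cong suc i≡j)) k

-- Lets the current through a new edge be evaluated at the ends of that edge, so that it no longer
-- depends on `v` except through `δ`.
δ-subst : ∀ {n} (i j : Fin n) (t : Fin n → ℤ) → δ i j * t j ≡ δ i j * t i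
δ-subst zero    zero    t = refl
δ-subst zero    (suc j) t = refl
δ-subst (suc i) zero    t = refl
δ-subst (suc i) (suc j) t = δ-subst i j (λ k → t (suc k))

∑-∣δ∣ : ∀ {n} (i : Fin n) (t : Fin n → ℤ) → ∑[ j < n ] (+ ∣ δ i j ∣ * t j) ≡ t i
∑-∣δ∣ i t = trans (sum-cong-≗ (λ j → cong (_* t j) (+∣δ∣≡δ i j))) (∑-δ i t)

-- Two graph operations and their effect on the Laplacian.

module _ (G : Graph) where
  open Graph G

  dipole : Vertex → Vertex → Divisor
  dipole s g v = δ s v - δ g v

  degree-dipole : ∀ s g → degree (dipole s g) ≡ 0ℤ
  degree-dipole s g = trans (∑-minus (δ s) (δ g))
    (cong₂ _-_ (degree-δ s) (degree-δ g))
    where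
    degree-δ : ∀ i → degree (δ i) ≡ 1ℤ
    degree-δ i = trans (sum-cong-≗ (λ j → sym (ℤ.*-identityʳ (δ i j)))) (∑-δ i (λ _ → 1ℤ))

  ∑-dipole : ∀ s g (t : Vertex → ℤ) → ∑[ v < order ] (dipole s g v * t v) ≡ t s - t g
  ∑-dipole s g t = trans (sum-cong-≗ (λ v → distrib (δ s v) (δ g v) (t v)))
    (trans (∑-minus (λ v → δ s v * t v) (λ v → δ g v * t v)) (cong₂ _-_ (∑-δ s t) (∑-δ g t)))
    where
    distrib : ∀ a b x → (a - b) * x ≡ a * x - b * x
    distrib = solve-∀

  module _ (s : Vertex) where

    -- The new vertex is `zero`, a leaf hanging at `s`; the old vertices are shifted by `suc`.
    prolong : Graph
    prolong = record
      { order     = suc order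
      ; edges     = edges′
      ; edges-sym = edges′-sym
      ; loopless  = λ { zero → refl ; (suc v) → loopless v }
      ; nonempty  = ℕ.s≤s ℕ.z≤n
      ; connected = connected′
      }
      where
      edges′ : Fin (suc order) → Fin (suc order) → ℕ
      edges′ zero    zero    = 0
      edges′ zero    (suc w) = ∣ δ s w ∣
      edges′ (suc v) zero    = ∣ δ s v ∣
      edges′ (suc v) (suc w) = edges v w

      edges′-sym : ∀ v w → edges′ v w ≡ edges′ w v
      edges′-sym zero    zero    = refl
      edges′-sym zero    (suc w) = refl
      edges′-sym (suc v) zero    = refl
      edges′-sym (suc v) (suc w) = edges-sym v w

      lift : ∀ {v w} → Star (λ x y → 0 ℕ.< edges x y) v w →
             Star (λ x y → 0 ℕ.< edges′ x y) (suc v) (suc w)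
      lift = gmap suc (λ 0<e → 0<e)

      connected′ : ∀ v w → Star (λ x y → 0 ℕ.< edges′ x y) v w
      connected′ zero    zero    = ε
      connected′ zero    (suc w) = 0<∣δ∣ s ◅ lift (connected s w)
      connected′ (suc v) zero    = lift (connected v s) ◅◅ (0<∣δ∣ s ◅ ε)
      connected′ (suc v) (suc w) = lift (connected v w)

    div-prolong-zero : ∀ h → Graph.div prolong h zero ≡ h zero - h (suc s)
    div-prolong-zero h = trans (ℤ.+-identityˡ _) (∑-∣δ∣ s (λ w → h zero - h (suc w)))

    -- Among the old vertices only `s` meets the new edge, so only there a correction appears.
    div-prolong-suc : ∀ h v → Graph.div prolong h (suc v) ≡
                      div (λ w → h (suc w)) v + δ s v * (h (suc s) - h zero)
    div-prolong-suc h v = begin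
      + ∣ δ s v ∣ * (h (suc v) - h zero) + div h⁺ v ≡⟨ cong (λ x → x * (h (suc v) - h zero) + div h⁺ v) (+∣δ∣≡δ s v) ⟩
      δ s v * (h (suc v) - h zero) + div h⁺ v       ≡⟨ cong (_+ div h⁺ v) (δ-subst s v (λ w → h (suc w) - h zero)) ⟩
      δ s v * (h (suc s) - h zero) + div h⁺ v       ≡⟨ ℤ.+-comm _ (div h⁺ v) ⟩
      div h⁺ v + δ s v * (h (suc s) - h zero)       ∎
      where
      open ≡-Reasoning
      h⁺ : Vertex → ℤ
      h⁺ w = h (suc w)

  module _ (s g : Vertex) (s≢g : s ≢ g) where

    -- The summand in `edges` is the indicator of the ordered pair (s, g) made symmetric; it is
    -- added to the existing number of edges, so parallel edges may arise.
    addEdge : Graph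
    addEdge = record
      { order     = order
      ; edges     = λ v w → edges v w ℕ.+ (∣ δ s v ∣ ℕ.* ∣ δ g w ∣ ℕ.+ ∣ δ g v ∣ ℕ.* ∣ δ s w ∣)
      ; edges-sym = λ v w → cong₂ ℕ._+_ (edges-sym v w) (trans
          (ℕ.+-comm (∣ δ s v ∣ ℕ.* ∣ δ g w ∣) (∣ δ g v ∣ ℕ.* ∣ δ s w ∣))
          (cong₂ ℕ._+_ (ℕ.*-comm ∣ δ g v ∣ ∣ δ s w ∣) (ℕ.*-comm ∣ δ s v ∣ ∣ δ g w ∣)))
      ; loopless  = λ v → cong₂ ℕ._+_ (loopless v) (cong₂ ℕ._+_
          (∣δ∣*∣δ∣≡0 s≢g v) (∣δ∣*∣δ∣≡0 (λ g≡s → s≢g (sym g≡s)) v))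
      ; nonempty  = nonempty
      ; connected = λ v w → map (λ 0<e → ℕ.≤-trans 0<e (ℕ.m≤m+n _ _)) (connected v w)
      }

    -- One new edge changes the Laplacian by a matrix of rank one, the dipole times its own
    -- transpose.
    div-addEdge : ∀ h v → Graph.div addEdge h v ≡ div h v + dipole s g v * (h s - h g)
    div-addEdge h v = begin
      ∑[ w < order ] (+ (edges v w ℕ.+ (∣ δ s v ∣ ℕ.* ∣ δ g w ∣ ℕ.+ ∣ δ g v ∣ ℕ.* ∣ δ s w ∣)) * (h v - h w))
        ≡⟨ sum-cong-≗ (λ w → trans (cong (_* (h v - h w)) (cast w))
             (distrib (+ edges v w) (δ s v) (δ g w) (δ g v) (δ s w) (h v - h w))) ⟩
      ∑[ w < order ] (+ edges v w * (h v - h w) + (δ s v * (δ g w * (h v - h w)) + δ g v * (δ s w * (h v - h w))))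
        ≡⟨ ∑-distrib-+ (λ w → + edges v w * (h v - h w)) _ ⟩
      div h v + ∑[ w < order ] (δ s v * (δ g w * (h v - h w)) + δ g v * (δ s w * (h v - h w)))
        ≡⟨ cong (λ x → div h v + x) (∑-distrib-+ (λ w → δ s v * (δ g w * (h v - h w))) _) ⟩
      div h v + (∑[ w < order ] (δ s v * (δ g w * (h v - h w))) + ∑[ w < order ] (δ g v * (δ s w * (h v - h w))))
        ≡⟨ cong (λ x → div h v + x) (cong₂ _+_ (term s g) (term g s)) ⟩
      div h v + (δ s v * (h s - h g) + δ g v * (h g - h s))
        ≡⟨ collect (div h v) (δ s v) (δ g v) (h s) (h g) ⟩
      div h v + (δ s v - δ g v) * (h s - h g) ∎
      where
      open ≡-Reasoning
      product : ∀ (i j k l : Vertex) → + (∣ δ i j ∣ ℕ.* ∣ δ k l ∣) ≡ δ i j * δ k l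
      product i j k l = trans (ℤ.pos-* ∣ δ i j ∣ ∣ δ k l ∣) (cong₂ _*_ (+∣δ∣≡δ i j) (+∣δ∣≡δ k l))
      cast : ∀ w → + (edges v w ℕ.+ (∣ δ s v ∣ ℕ.* ∣ δ g w ∣ ℕ.+ ∣ δ g v ∣ ℕ.* ∣ δ s w ∣)) ≡
                   + edges v w + (δ s v * δ g w + δ g v * δ s w)
      cast w = cong (λ x → + edges v w + x) (cong₂ _+_ (product s v g w) (product g v s w))
      term : ∀ i j → ∑[ w < order ] (δ i v * (δ j w * (h v - h w))) ≡ δ i v * (h i - h j)
      term i j = trans (∑-*ˡ (δ i v) (λ w → δ j w * (h v - h w)))
        (trans (cong (δ i v *_) (∑-δ j (λ w → h v - h w))) (δ-subst i v (λ w → h w - h j)))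
      distrib : ∀ e a b c d x → (e + (a * b + c * d)) * x ≡ e * x + (a * (b * x) + c * (d * x))
      distrib = solve-∀
      collect : ∀ e a b x y → e + (a * (x - y) + b * (y - x)) ≡ e + (a - b) * (x - y)
      collect = solve-∀

-- Networks and their series and parallel extensions.

-- A current q from the source to the ground causes the voltage p.
record Network (p q : ℕ) : Set where
  field
    graph : Graph
  open Graph graph public
  field
    source ground : Vertex
    voltage       : Vertex → ℤ
    voltage-drop  : voltage source - voltage ground ≡ + p
    div-voltage   : ∀ v → div voltage v ≡ + q * dipole graph source ground v
    -- Divisors of every degree are allowed, with separate coefficients at the two terminals, so
    -- that the inductive steps need not keep track of degrees. In degree zero `c + d` vanishes, and
    -- then `E` is equivalent to `c` times the dipole.
    generated     : ∀ (E : Divisor) → ∃ λ c → ∃ λ d → ∃ λ h →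
                    ∀ v → E v ≡ c * δ source v + d * δ ground v + div h v

-- The terminals coincide, so the dipole is zero and the current could be any number; the value 1
-- makes one prolongation yield the unit resistor, of resistance 1 / 1.
trivial : Network 0 1
trivial = record
  { graph        = record
    { order     = 1
    ; edges     = λ _ _ → 0
    ; edges-sym = λ _ _ → refl
    ; loopless  = λ _ → refl
    ; nonempty  = ℕ.s≤s ℕ.z≤n
    ; connected = λ { zero zero → ε }
    }
  ; source       = zero
  ; ground       = zero
  ; voltage      = λ _ → 0ℤ
  ; voltage-drop = refl
  ; div-voltage  = λ { zero → refl }
  ; generated    = λ E → E zero , 0ℤ , (λ _ → 0ℤ) , λ { zero → lemma (E zero) }
  }
  where
  lemma : ∀ e → e ≡ e * 1ℤ + 0ℤ + 0ℤ
  lemma = solve-∀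

series : ∀ {p q} → Network p q → Network (p ℕ.+ q) q
series {p} {q} N = record
  { graph        = prolong graph source
  ; source       = zero
  ; ground       = suc ground
  ; voltage      = voltage′
  ; voltage-drop = trans (reorder (voltage source) (+ q) (voltage ground)) (cong (_+ + q) voltage-drop)
  ; div-voltage  = λ where
      zero    → trans (div-prolong-zero graph source voltage′) (drop (voltage source) (+ q))
      (suc v) → trans (div-prolong-suc graph source voltage′ v)
        (trans (cong (λ x → x + δ source v * (voltage source - (voltage source + + q))) (div-voltage v))
          (push (+ q) (δ source v) (δ ground v) (voltage source)))
  ; generated    = generated′
  }
  where
  open Network N
  voltage′ : Fin (suc order) → ℤ
  -- The whole current q passes through the new unit resistor, which therefore adds a drop of q.
  voltage′ zero    = voltage source + + q
  voltage′ (suc v) = voltage v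
  reorder : ∀ a b c → a + b - c ≡ a - c + b
  reorder = solve-∀
  drop : ∀ a b → a + b - a ≡ b * (1ℤ - 0ℤ)
  drop = solve-∀
  push : ∀ q a b x → q * (a - b) + a * (x - (x + q)) ≡ q * (0ℤ - b)
  push = solve-∀
  solve₀ : ∀ e c d x → e ≡ (e + c) * 1ℤ + d * 0ℤ + (x - c - x)
  solve₀ = solve-∀
  solve₁ : ∀ e c d a b x y → c * a + d * b + y ≡ (e + c) * 0ℤ + d * b + (y + a * (x - (x - c)))
  solve₁ = solve-∀
  generated′ : ∀ (E : Fin (suc order) → ℤ) → ∃ λ c → ∃ λ d → ∃ λ h → ∀ v →
    E v ≡ c * δ zero v + d * δ (suc ground) v + Graph.div (prolong graph source) h v
  generated′ E with c , d , h , E≡ ← generated (λ v → E (suc v))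
    = E zero + c , d , h′ , λ where
        zero    → trans (solve₀ (E zero) c d (h source))
          (cong (λ x → (E zero + c) * 1ℤ + d * 0ℤ + x) (sym (div-prolong-zero graph source h′)))
        (suc v) → trans (E≡ v) (trans
          (solve₁ (E zero) c d (δ source v) (δ ground v) (h source) (div h v))
          (cong (λ x → (E zero + c) * 0ℤ + d * δ ground v + x) (sym (div-prolong-suc graph source h′ v))))
    where
    h′ : Fin (suc order) → ℤ
    -- This value makes the new edge contribute `c` at the old source and `- c` at the new one, so
    -- the coefficient `c` moves from the old terminal to the new.
    h′ zero    = h source - c
    h′ (suc v) = h v

-- The voltage is kept: the new edge sees the drop p, hence carries the additional current p. A
-- nonzero drop also forces the terminals to be distinct.
parallel : ∀ {p q} .{{_ : NonZero p}} → Network p q → Network p (p ℕ.+ q)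
parallel {p@(suc _)} {q} N = record
  { graph        = addEdge graph source ground source≢ground
  ; source       = source
  ; ground       = ground
  ; voltage      = voltage
  ; voltage-drop = voltage-drop
  ; div-voltage  = λ v → trans (div-addEdge′ voltage v) (trans
      (cong₂ (λ x y → x + dipole graph source ground v * y) (div-voltage v) voltage-drop)
      (merge (+ p) (+ q) (dipole graph source ground v)))
  -- The new edge adds `k` times the dipole to the divisor of `h`; the coefficients at the terminals
  -- absorb this.
  ; generated    = λ E → let c , d , h , E≡ = generated E ; k = h source - h ground in
      c - k , d + k , h , λ v → trans (E≡ v) (trans
        (shift c d k (δ source v) (δ ground v) (div h v))
        (cong (λ x → (c - k) * δ source v + (d + k) * δ ground v + x) (sym (div-addEdge′ h v))))
  }
  where
  open Network N
  source≢ground : source ≢ ground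
  source≢ground eq
    with () ← trans (sym (ℤ.+-inverseʳ (voltage ground)))
                (trans (cong (λ x → voltage x - voltage ground) (sym eq)) voltage-drop)
  div-addEdge′ : ∀ h v → Graph.div (addEdge graph source ground source≢ground) h v ≡
                 div h v + dipole graph source ground v * (h source - h ground)
  div-addEdge′ = div-addEdge graph source ground source≢ground
  merge : ∀ p q x → q * x + x * p ≡ (p + q) * x
  merge = solve-∀
  shift : ∀ c d k a b y → c * a + d * b + y ≡ (c - k) * a + (d + k) * b + (y + (a - b) * k)
  shift = solve-∀

-- The subtractive Euclidean algorithm.

coprime⇒network : ∀ p q .{{_ : NonZero p}} .{{_ : NonZero q}} → Coprime p q → Network p q
coprime⇒network (suc m) (suc n) = euclid m n (<-wellFounded (m ℕ.+ n))
  where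
  euclid : ∀ m n → Acc ℕ._<_ (m ℕ.+ n) → Coprime (suc m) (suc n) → Network (suc m) (suc n)
  euclid m n (acc rec) m⊥n with ℕ.compare m n
  -- Equal coprime numbers are both 1, and 1 / 1 is a single resistor.
  ... | equal m with refl ← m⊥n (ℕ.∣-refl , ℕ.∣-refl) = series trivial
  -- Both arguments of `euclid` are predecessors, so `q - p` is `suc k`; a parallel edge restores q.
  ... | less m k = subst (Network (suc m)) (cong suc (ℕ.+-suc m k))
    (parallel (euclid m k (rec (ℕ.+-monoʳ-< m (ℕ.s≤s (ℕ.m≤n+m k m))))
      (λ {d} (d∣m , d∣k) → m⊥n (d∣m , subst (d ℕ.∣_) (cong suc (ℕ.+-suc m k)) (ℕ.∣m∣n⇒∣m+n d∣m d∣k)))))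
  -- Here `p - q` is `suc k`, and a resistor in series restores p.
  ... | greater n k = subst (λ x → Network x (suc n)) k+n≡
    (series (euclid k n (rec (ℕ.+-monoˡ-< n (ℕ.s≤s (ℕ.m≤n+m k n))))
      (λ {d} (d∣k , d∣n) → m⊥n (subst (d ℕ.∣_) k+n≡ (ℕ.∣m∣n⇒∣m+n d∣k d∣n) , d∣n))))
    where
    k+n≡ : suc k ℕ.+ suc n ≡ suc (suc (n ℕ.+ k))
    k+n≡ = trans (ℕ.+-comm (suc k) (suc n)) (cong suc (ℕ.+-suc n k))

-- The Jacobian of a network.

-- The finiteness witness is a parameter, so that `cyclic r P` is an instance of this by definition.
cyclicGroup : ∀ n → Finite (AbelianGroup.setoid (ℤ/ n)) → Pairing (ℤ/ n) → GroupWithPairing 0ℓ 0ℓ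
cyclicGroup n finite P = record { abelianGroup = ℤ/ n ; finite = finite ; pairing = P }

-- The multiplier `u` of the pairing may be negative, whereas the voltage drop p is natural; it is
-- enough that they agree modulo n.
module _ {p n} .{{n≢0 : NonZero n}} (N : Network p n)
         (finite : Finite (AbelianGroup.setoid (ℤ/ n))) (P : Pairing (ℤ/ n))
         (u : ℤ) (n∣p-u : + n ∣ + p - u)
         (⟨⟩≈u/n : ∀ x y → Pairing.⟨_,_⟩ P x y ℚ/ℤ.≈ (u * x * y) / n) where
  open Network N
  private
    D : Divisor
    D = dipole graph source ground

    degree-* : ∀ x → degree (λ v → x * D v) ≡ 0ℤ
    degree-* x = trans (∑-*ˡ x D) (trans (cong (x *_) (degree-dipole graph source ground)) (ℤ.*-zeroʳ x))

    module Z = GroupWithPairing (cyclicGroup n finite P)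
    module J = GroupWithPairing (Jac (Network.graph N))

    to : ℤ → J.Carrier
    to x = (λ v → x * D v) , degree-* x

    -- The voltage, scaled by `x`, is an explicit potential, with the current n in the role of the
    -- multiplier `m`.
    multiple : ∀ x → Potential graph (λ v → x * D v)
    multiple x = record
      { m         = n
      -- The instance at hand is irrelevant while this field is not, so the proof is rebuilt from
      -- `n > 0`.
      ; m≢0       = ℕ.>-nonZero (ℕ.>-nonZero⁻¹ n)
      ; f         = λ v → x * voltage v
      ; div-f≡m*D = λ v → trans (div-* graph x voltage v)
          (trans (cong (x *_) (div-voltage v)) (swap x (+ n) (D v)))
      }
      where
      swap : ∀ x m d → x * (m * d) ≡ m * (x * d)
      swap = solve-∀

    monodromy-multiple : ∀ x y → monodromy graph (multiple x) (λ v → y * D v) ≡ (+ p * x * y) / n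
    monodromy-multiple x y = cong (_/ n) (begin
      ∑[ v < order ] (y * D v * (x * voltage v))    ≡⟨ sum-cong-≗ (λ v → regroup x y (D v) (voltage v)) ⟩
      ∑[ v < order ] (x * y * (D v * voltage v))    ≡⟨ ∑-*ˡ (x * y) (λ v → D v * voltage v) ⟩
      x * y * ∑[ v < order ] (D v * voltage v)      ≡⟨ cong (x * y *_) (trans (∑-dipole graph source ground voltage) voltage-drop) ⟩
      x * y * + p                                   ≡⟨ reorder x y (+ p) ⟩
      + p * x * y                                   ∎)
      where
      open ≡-Reasoning
      regroup : ∀ x y d f → y * d * (x * f) ≡ x * y * (d * f)
      regroup = solve-∀
      reorder : ∀ x y p → x * y * p ≡ p * x * y
      reorder = solve-∀

    -- By `monodromy-unique` the opaque choice of potential may be exchanged for `multiple x`. The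
    -- pairing sum is then x y times the voltage drop p, and p is replaced by `u` modulo n.
    preserves : ∀ x y → J.⟨ to x , to y ⟩ ℚ/ℤ.≈ Z.⟨ x , y ⟩
    preserves x y =
      ℚ/ℤ.trans {J.⟨ to x , to y ⟩} {monodromy graph (multiple x) (λ v → y * D v)} {Z.⟨ x , y ⟩}
        (≃⇒≈ (monodromy-unique graph (potential graph _ (degree-* x)) (multiple x) _ (degree-* y)))
        (subst (ℚ/ℤ._≈ Z.⟨ x , y ⟩) (sym (monodromy-multiple x y))
          (ℚ/ℤ.trans {(+ p * x * y) / n} {(u * x * y) / n} {Z.⟨ x , y ⟩}
            (p/n≈u/n n∣p-u) (ℚ/ℤ.sym {Z.⟨ x , y ⟩} {(u * x * y) / n} (⟨⟩≈u/n x y))))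
      where
      factor : ∀ p u x y n → p * x * y * n - u * x * y * n ≡ (p - u) * (x * y * n)
      factor = solve-∀
      regroup : ∀ k x y n → k * n * (x * y * n) ≡ k * x * y * (n * n)
      regroup = solve-∀
      p/n≈u/n : + n ∣ + p - u → (+ p * x * y) / n ℚ/ℤ.≈ (u * x * y) / n
      p/n≈u/n (divides k p-u≡k*n) = /-≈-intro (+ p * x * y) (u * x * y) n n (k * x * y)
        (trans (factor (+ p) u x y (+ n)) (trans (cong (_* (x * y * + n)) p-u≡k*n)
          (regroup k x y (+ n))))

    to-homo : ∀ x y → to (x + y) J.≈ to x J.∙ to y
    to-homo x y = quotient-reflexive (Div⁰ graph) (Principal graph) {to (x + y)} {to x J.∙ to y}
      (λ v → ℤ.*-distribʳ-+ (D v) x y)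

    to-⁻¹ : ∀ x → to (- x) J.≈ to x J.⁻¹
    to-⁻¹ x = quotient-reflexive (Div⁰ graph) (Principal graph) {to (- x)} {to x J.⁻¹}
      (λ v → sym (ℤ.neg-distribˡ-* x (D v)))

    -- The dipole is killed by n, since n times it is the divisor of the voltage.
    to-cong : ∀ {x y} → x Z.≈ y → to x J.≈ to y
    to-cong {x} {y} (divides k x-y≡k*n) = (λ v → k * voltage v) , λ v → begin
      x * D v - y * D v     ≡⟨ factor x y (D v) ⟩
      (x - y) * D v         ≡⟨ cong (_* D v) x-y≡k*n ⟩
      k * + n * D v         ≡⟨ ℤ.*-assoc k (+ n) (D v) ⟩
      k * (+ n * D v)       ≡⟨ cong (k *_) (div-voltage v) ⟨
      k * div voltage v     ≡⟨ div-* graph k voltage v ⟨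
      div (λ w → k * voltage w) v ∎
      where
      open ≡-Reasoning
      factor : ∀ x y d → x * d - y * d ≡ (x - y) * d
      factor = solve-∀

    -- Non-degeneracy of `P` replaces any computation of the order of the Jacobian: as `to`
    -- preserves the pairings, an element of its kernel is orthogonal to everything.
    kernel-trivial : ∀ x → to x J.≈ J.ε → x Z.≈ 0ℤ
    kernel-trivial x to-x≈0 = Z.nondegenerate x (λ y →
      ℚ/ℤ.trans {Z.⟨ x , y ⟩} {J.⟨ to x , to y ⟩} {ℚ/ℤ.ε}
        (ℚ/ℤ.sym {J.⟨ to x , to y ⟩} {Z.⟨ x , y ⟩} (preserves x y))
        (ℚ/ℤ.trans {J.⟨ to x , to y ⟩} {J.⟨ J.ε , to y ⟩} {ℚ/ℤ.ε}
          (J.⟨⟩-cong {to x} {J.ε} {to y} {to y} to-x≈0 (J.refl {to y}))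
          (ℚ/ℤ.trans {J.⟨ J.ε , to y ⟩} {J.⟨ to y , J.ε ⟩} {ℚ/ℤ.ε}
            -- The zero divisor is moved to the second slot, where the defining sum is visibly zero.
            (J.symmetric J.ε (to y))
            (≃⇒≈ (monodromy-0 graph (potential graph _ (degree-* y)))))))

    to-injective : ∀ {x y} → to x J.≈ to y → x Z.≈ y
    to-injective {x} {y} (h , eq) = subst (+ n ∣_) (ℤ.+-identityʳ (x - y))
      (kernel-trivial (x - y) (h , λ v → trans (expand x y (D v)) (eq v)))
      where
      expand : ∀ x y d → (x - y) * d + - 0ℤ ≡ x * d - y * d
      expand = solve-∀

    -- Taking degrees in `generated` gives `c + d` = 0, so the terminal part of `E` is `c` times the
    -- dipole. The sign of the witness comes from comparing `to c` minus `E`, not the reverse.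
    to-surjective : ∀ E → ∃ λ x → to x J.≈ E
    to-surjective (E , degree-E≡0) with c , d , h , E≡ ← generated E =
      c , (λ v → - 1ℤ * h v) , λ v → begin
        c * D v - E v
          ≡⟨ cong (λ x → c * D v - x) (E≡ v) ⟩
        c * D v - (c * δ source v + d * δ ground v + div h v)
          ≡⟨ collect c d (δ source v) (δ ground v) (div h v) ⟩
        - (c + d) * δ ground v + - 1ℤ * div h v
          ≡⟨ cong (λ x → - x * δ ground v + - 1ℤ * div h v) c+d≡0 ⟩
        0ℤ + - 1ℤ * div h v
          ≡⟨ ℤ.+-identityˡ _ ⟩
        - 1ℤ * div h v
          ≡⟨ div-* graph (- 1ℤ) h v ⟨
        div (λ w → - 1ℤ * h w) v ∎
      where
      open ≡-Reasoning
      collect : ∀ c d a b y → c * (a - b) - (c * a + d * b + y) ≡ - (c + d) * b + - 1ℤ * y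
      collect = solve-∀
      c+d≡0 : c + d ≡ 0ℤ
      c+d≡0 = begin
        c + d
          ≡⟨ cong₂ _+_ (∑-δ source (λ _ → c)) (∑-δ ground (λ _ → d)) ⟨
        ∑[ v < order ] (δ source v * c) + ∑[ v < order ] (δ ground v * d)
          ≡⟨ cong₂ _+_ (sum-cong-≗ (λ v → ℤ.*-comm (δ source v) c)) (sum-cong-≗ (λ v → ℤ.*-comm (δ ground v) d)) ⟩
        ∑[ v < order ] (c * δ source v) + ∑[ v < order ] (d * δ ground v)
          ≡⟨ ∑-distrib-+ (λ v → c * δ source v) (λ v → d * δ ground v) ⟨
        ∑[ v < order ] (c * δ source v + d * δ ground v)
          ≡⟨ ℤ.+-identityʳ _ ⟨
        ∑[ v < order ] (c * δ source v + d * δ ground v) + 0ℤ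
          ≡⟨ cong (λ x → ∑[ v < order ] (c * δ source v + d * δ ground v) + x) (degree-div graph h) ⟨
        ∑[ v < order ] (c * δ source v + d * δ ground v) + degree (div h)
          ≡⟨ ∑-distrib-+ (λ v → c * δ source v + d * δ ground v) (div h) ⟨
        ∑[ v < order ] (c * δ source v + d * δ ground v + div h v)
          ≡⟨ sum-cong-≗ E≡ ⟨
        degree E
          ≡⟨ degree-E≡0 ⟩
        0ℤ ∎

  Jac-network : cyclicGroup n finite P ≅ Jac (Network.graph N)
  Jac-network = record
    { to                 = to
    ; isGroupIsomorphism = record
      { isGroupMonomorphism = record
        { isGroupHomomorphism = record
          { isMonoidHomomorphism = record
            { isMagmaHomomorphism = record
              { isRelHomomorphism = record { cong = λ {x} {y} → to-cong {x} {y} }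
              ; homo              = to-homo
              }
            ; ε-homo = quotient-reflexive (Div⁰ graph) (Principal graph) {to 0ℤ} {J.ε} (λ v → refl)
            }
          ; ⁻¹-homo = to-⁻¹
          }
        ; injective = λ {x} {y} → to-injective {x} {y}
        }
      ; surjective = λ E → let x , to-x≈E = to-surjective E in
          x , λ {z} z≈x → J.trans {to z} {to x} {E} (to-cong {z} {x} z≈x) to-x≈E
      }
    ; preserves-⟨⟩       = preserves
    }

-- From a unit modulo n to a network, and the theorem.

-- A common divisor of p and n also divides `u`, which is p minus a multiple of n.
coprime-congruent : ∀ {p n} u → + n ∣ + p - u → Coprime n ∣ u ∣ → Coprime p n
coprime-congruent {p} {n} u n∣p-u n⊥u {d} (d∣p , d∣n) = n⊥u (d∣n , ∣⇒∣ᵤ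
  (subst (+ d ∣_) (cancel (+ p) u)
    (∣m∣n⇒∣m-n {m = + p} (∣ᵤ⇒∣ d∣p) (∣-trans {+ d} {+ n} (∣ᵤ⇒∣ d∣n) n∣p-u))))
  where
  cancel : ∀ p u → p - (p - u) ≡ u
  cancel = solve-∀

-- The remainder of `u` can be 0, for instance when n = 1; adding n gives the nonzero numerator that
-- `coprime⇒network` requires.
positiveResidue : ∀ n .{{_ : NonZero n}} u → ∃ λ p → NonZero p × + n ∣ + p - u
positiveResidue n u = n ℕ.+ r , ℕ.>-nonZero (ℕ.≤-trans (ℕ.>-nonZero⁻¹ n) (ℕ.m≤m+n n r)) ,
  divides (1ℤ - k) (trans (cong (λ x → + (n ℕ.+ r) - x) (ℤ.a≡a%ℕn+[a/ℕn]*n u n)) (lemma (+ n) (+ r) k))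
  where
  r : ℕ
  r = u ℤ.%ℕ n
  k : ℤ
  k = u ℤ./ℕ n
  lemma : ∀ n r k → n + r - (r + k * n) ≡ (1ℤ - k) * n
  lemma = solve-∀

-- For a unit `u` the fraction p / n, with p the positive representative, is in lowest terms, so the
-- Euclidean algorithm builds the network.
pairing-realised : ∀ n .{{_ : NonZero n}} (finite : Finite (AbelianGroup.setoid (ℤ/ n)))
                   (P : Pairing (ℤ/ n)) u → Coprime n ∣ u ∣ →
                   (∀ x y → Pairing.⟨_,_⟩ P x y ℚ/ℤ.≈ (u * x * y) / n) →
                   ∃ λ G → cyclicGroup n finite P ≅ Jac G
pairing-realised n finite P u n⊥u ⟨⟩≈u/n =
  let p , p≢0 , n∣p-u = positiveResidue n u
      N = coprime⇒network p n {{p≢0}} (coprime-congruent u n∣p-u n⊥u)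
  in Network.graph N , Jac-network N finite P u n∣p-u ⟨⟩≈u/n

theorem4 : ∀ {c ℓ} (r : ℕ) → r ≥ 1 →
    (Γ : GroupWithPairing c ℓ) (P : Pairing (ℤ/ (2 ^ r))) →
    NonExceptional r P → Γ ≅ cyclic r P →
    ∃ λ (G : Graph) → Γ ≅ Jac G
theorem4 r _ Γ P nonExceptional Γ≅P = realise nonExceptional
  where
  -- The four types differ only in the odd multiplier `u`, which is coprime to 2 ^ r.
  via : ∀ u {u-odd : False (2 ℕ.∣? ∣ u ∣)} → cyclic r P ≅ cyclic r (oddPairing r u {u-odd}) →
        ∃ λ G → Γ ≅ Jac G
  via u {u-odd} P≅u =
    let Q = oddPairing r u {u-odd}
        G , u≅Jac = pairing-realised (2 ^ r) {{2^ r -nonZero}} _ Q u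
          (2^r⊥odd r (toWitnessFalse u-odd)) (λ x y → ℚ/ℤ.refl {Pairing.⟨_,_⟩ Q x y})
    in G , ≅-trans Γ≅P (≅-trans P≅u u≅Jac)

  realise : NonExceptional r P → ∃ λ G → Γ ≅ Jac G
  realise (+1-type _ P≅u) = via (+ 1) P≅u
  realise (-1-type _ P≅u) = via (- + 1) P≅u
  realise (+5-type _ P≅u) = via (+ 5) P≅u
  realise (-5-type _ P≅u) = via (- + 5) P≅u
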